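{- For every integer $N\ge1$ and every integer $n\ge0$, the following identity holds (as rational functions in $x$): $$\sum_{l=0}^{n}(-1)^{n-l}\binom{N+n-l}{n-l}W_{l}^{(N+1)}(x)=\frac{1}{2^{N}N!}\sum_{i=1}^{N}\sum_{l=0}^{i}(-1)^{i-l}a_{i}(N)\frac{i!}{l!}\sum_{m+s+p=n}(-1)^{s}\binom{2N+m-i-1}{m}\binom{i-l+s}{s}(p+l)_{l}\,x^{i-2N-m}\,W_{p+l}(x),$$ where the innermost sum is over all integers $m,s,p\ge0$ with $m+s+p=n$.
   Context: The Chebyshev polynomials of the fourth kind $W_n(x)$ and the higher-order ones $W_n^{(\alpha)}(x)$ are defined by the formal power series in $t$ $$\frac{1+t}{1-2xt+t^{2}}=\sum_{n=0}^{\infty}W_{n}(x)t^{n},\qquad \left(\frac{1+t}{1-2xt+t^{2}}\right)^{\alpha}=\sum_{n=0}^{\infty}W_{n}^{(\alpha)}(x)t^{n}.$$ For a number $y$ and integer $n\ge1$, $(y)_{n}=y(y-1)\cdots(y-n+1)$ is the falling factorial, and $(y)_{0}=1$. The double factorial is $(2k-1)!!=(2k-1)(2k-3)\cdots 3\cdot 1$ for $k\ge1$, with $(-1)!!=1$. The numbers $a_i(N)$, $1\le i\le N$, are defined by $a_{1}(N)=(2N-3)!!$ and, for $2\le i\le N$, $$a_{i}(N)=\sum_{k_{i-1}=0}^{N-i}\ \sum_{k_{i-2}=0}^{N-i-k_{i-1}}\cdots\sum_{k_{1}=0}^{N-i-k_{i-1}-\cdots-k_{2}}2^{\sum_{j=1}^{i-1}k_{j}}\left[\prod_{j=2}^{i}\left(N-\sum_{l=j}^{i-1}k_{l}-\frac{2i+2-j}{2}\right)_{k_{j-1}}\right]\left(2\left(N-i-\sum_{j=1}^{i-1}k_{j}\right)-1\right)!!,$$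 where empty sums are $0$. -}

module Defs where

open import Algebra.Bundles.Raw using (RawMonoid; RawRing)
import Algebra.Definitions.RawMonoid as MonoidOps
import Algebra.Definitions.RawSemiring as SemiringOps
open import Data.Bool.Base using (if_then_else_)
open import Data.Fin.Base using (toℕ)
open import Data.Integer.Base using (ℤ; +_; -[1+_])
open import Data.List.Base using (List; []; _∷_; map)
open import Data.Nat.Base as ℕ using (ℕ; zero; suc; _∸_; _≡ᵇ_; _!)
import Data.Nat.Properties as ℕₚ
open import Data.Nat.Induction using (<-rec)
open import Data.Rational.Base as ℚ using (ℚ; 0ℚ; 1ℚ)
import Data.Rational.Properties as ℚₚ
open import Data.Sum.Base using (_⊎_; inj₁; inj₂; [_,_]′)
open import Level using (0ℓ)
open import Relation.Nullary.Decidable using (yes; no)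
open import Relation.Nullary.Negation using (¬_)
open import Relation.Binary.PropositionalEquality

-- The fold of f a, f (a + 1), …, f b; the unit if b < a.
bigOp : ∀ {c ℓ} (M : RawMonoid c ℓ) → ℕ → ℕ → (ℕ → RawMonoid.Carrier M) →
        RawMonoid.Carrier M
bigOp M a b f = MonoidOps.sum M {suc b ∸ a} (λ i → f (a ℕ.+ toℕ i))

∑ℕ : ℕ → ℕ → (ℕ → ℕ) → ℕ
∑ℕ = bigOp ℕ.+-0-rawMonoid

∑ℚ ∏ℚ : ℕ → ℕ → (ℕ → ℚ) → ℚ
∑ℚ = bigOp ℚ.+-0-rawMonoid
∏ℚ = bigOp ℚ.*-1-rawMonoid

infixr 5 ∑ℕ ∑ℚ ∏ℚ
syntax ∑ℕ a b (λ k → e) = ∑ℕ[ k ∈ a ⋯ b ] e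
syntax ∑ℚ a b (λ k → e) = ∑ℚ[ k ∈ a ⋯ b ] e
syntax ∏ℚ a b (λ k → e) = ∏ℚ[ k ∈ a ⋯ b ] e

open SemiringOps ℚ.+-*-rawSemiring public using () renaming (_^_ to _^ℚ_)

fromℕ : ℕ → ℚ
fromℕ n = + n ℚ./ 1

sgn : ℕ → ℚ
sgn k = (ℚ.- 1ℚ) ^ℚ k

_!/_! : ℕ → ℕ → ℚ
i !/ l ! = + (i !) ℚ./ (l !)
  where instance _ = l ℕₚ.!≢0

1/2^_*_! : ℕ → ℕ → ℚ
1/2^ M * N ! = + 1 ℚ./ (2 ℕ.^ M ℕ.* N !)
  where instance
    _ = N ℕₚ.!≢0
    _ = ℕₚ.m^n≢0 2 M
    _ = ℕₚ.m*n≢0 (2 ℕ.^ M) (N !)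

fallingFactorial : ℚ → ℕ → ℚ
fallingFactorial y zero    = 1ℚ
fallingFactorial y (suc n) = fallingFactorial y n ℚ.* (y ℚ.- fromℕ n)

-- (2k-1)!! as a function of k
⟨2_-1⟩!! : ℕ → ℕ
⟨2 zero  -1⟩!! = 1
⟨2 suc k -1⟩!! = (2 ℕ.* k ℕ.+ 1) ℕ.* ⟨2 k -1⟩!!

infixl 20 _[_≔_]
_[_≔_] : (ℕ → ℕ) → ℕ → ℕ → (ℕ → ℕ)
(k [ r ≔ v ]) l = if l ≡ᵇ r then v else k l

-- nested∑ r M g is
--   ∑_{k_r = 0}^{M} ∑_{k_{r-1} = 0}^{M - k_r} ⋯ ∑_{k_1 = 0}^{M - k_r - ⋯ - k_2} g k
-- with k 0 outside 1, …, r.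
nested∑ : ℕ → ℕ → ((ℕ → ℕ) → ℚ) → ℚ
nested∑ zero    M g = g (λ _ → 0)
nested∑ (suc r) M g =
  ∑ℚ[ v ∈ 0 ⋯ M ] nested∑ r (M ∸ v) (λ k → g (k [ suc r ≔ v ]))

-- Only meaningful for 1 ≤ i ≤ N; then no truncated subtraction below is
-- applied outside its range.
a : (i N : ℕ) → ℚ
a 1 N = fromℕ ⟨2 N ∸ 1 -1⟩!!
a i N = nested∑ (i ∸ 1) (N ∸ i) λ k →
  fromℕ (2 ℕ.^ (∑ℕ[ j ∈ 1 ⋯ i ∸ 1 ] k j))
  ℚ.* (∏ℚ[ j ∈ 2 ⋯ i ]
         fallingFactorial
           (fromℕ N ℚ.- fromℕ (∑ℕ[ l ∈ j ⋯ i ∸ 1 ] k l)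
                    ℚ.- (+ (2 ℕ.* i ℕ.+ 2 ∸ j) ℚ./ 2))
           (k (j ∸ 1)))
  ℚ.* fromℕ ⟨2 N ∸ i ∸ (∑ℕ[ j ∈ 1 ⋯ i ∸ 1 ] k j) -1⟩!!

-- ℚ[x] as coefficient lists, constant term first; trailing zeros are
-- allowed, so equality is _≈ₚ_.
Poly : Set
Poly = List ℚ

coeff : Poly → ℕ → ℚ
coeff []      n       = 0ℚ
coeff (c ∷ p) zero    = c
coeff (c ∷ p) (suc n) = coeff p n

infix 4 _≈ₚ_
_≈ₚ_ : Poly → Poly → Set
p ≈ₚ q = ∀ n → coeff p n ≡ coeff q n

infixl 6 _+ₚ_
_+ₚ_ : Poly → Poly → Poly
[]      +ₚ q       = q
p       +ₚ []      = p
(c ∷ p) +ₚ (d ∷ q) = (c ℚ.+ d) ∷ (p +ₚ q)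

infixl 7 _*ₚ_
_*ₚ_ : Poly → Poly → Poly
[]      *ₚ q = []
(c ∷ p) *ₚ q = map (c ℚ.*_) q +ₚ (0ℚ ∷ (p *ₚ q))

-ₚ_ : Poly → Poly
-ₚ_ = map (ℚ.-_)

constₚ : ℚ → Poly
constₚ c = c ∷ []

X : Poly
X = 0ℚ ∷ 1ℚ ∷ []

polyRawRing : RawRing 0ℓ 0ℓ
polyRawRing = record
  { Carrier = Poly
  ; _≈_     = _≈ₚ_
  ; _+_     = _+ₚ_
  ; _*_     = _*ₚ_
  ; -_      = -ₚ_
  ; 0#      = []
  ; 1#      = constₚ 1ℚ
  }

private
  coeff-+ : ∀ p q n → coeff (p +ₚ q) n ≡ coeff p n ℚ.+ coeff q n
  coeff-+ []      q       n       = sym (ℚₚ.+-identityˡ _)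
  coeff-+ (c ∷ p) []      n       = sym (ℚₚ.+-identityʳ _)
  coeff-+ (c ∷ p) (d ∷ q) zero    = refl
  coeff-+ (c ∷ p) (d ∷ q) (suc n) = coeff-+ p q n

  coeff-scale : ∀ c q n → coeff (map (c ℚ.*_) q) n ≡ c ℚ.* coeff q n
  coeff-scale c []      n       = sym (ℚₚ.*-zeroʳ c)
  coeff-scale c (d ∷ q) zero    = refl
  coeff-scale c (d ∷ q) (suc n) = coeff-scale c q n

  coeff-∷* : ∀ c p q n →
    coeff ((c ∷ p) *ₚ q) n ≡ c ℚ.* coeff q n ℚ.+ coeff (0ℚ ∷ (p *ₚ q)) n
  coeff-∷* c p q n =
    trans (coeff-+ (map (c ℚ.*_) q) _ n) (cong (ℚ._+ _) (coeff-scale c q n))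

  coeff-*-low : ∀ p q m → (∀ k → k ℕ.≤ m → coeff q k ≡ 0ℚ) →
                coeff (p *ₚ q) m ≡ 0ℚ
  coeff-*-low []      q m       q≡0 = refl
  coeff-*-low (c ∷ p) q m       q≡0 = trans (coeff-∷* c p q m)
    (cong₂ ℚ._+_ (trans (cong (c ℚ.*_) (q≡0 m ℕₚ.≤-refl)) (ℚₚ.*-zeroʳ c)) (tail m q≡0))
    where
    tail : ∀ m → (∀ k → k ℕ.≤ m → coeff q k ≡ 0ℚ) → coeff (0ℚ ∷ (p *ₚ q)) m ≡ 0ℚ
    tail zero    _   = refl
    tail (suc m) q≡0 = coeff-*-low p q m (λ k k≤m → q≡0 k (ℕₚ.m≤n⇒m≤1+n k≤m))

*ₚ-noZeroDivisors : ∀ p q → p *ₚ q ≈ₚ [] → p ≈ₚ [] ⊎ q ≈ₚ []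
*ₚ-noZeroDivisors []      q _    = inj₁ (λ _ → refl)
*ₚ-noZeroDivisors (c ∷ p) q pq≈0 with c ℚₚ.≟ 0ℚ
... | yes refl = [ (λ p≈0 → inj₁ λ { zero → refl ; (suc n) → p≈0 n }) , inj₂ ]′
                 (*ₚ-noZeroDivisors p q λ n → trans (sym (shift n)) (pq≈0 (suc n)))
  where
  shift : ∀ n → coeff ((0ℚ ∷ p) *ₚ q) (suc n) ≡ coeff (p *ₚ q) n
  shift n = trans (coeff-∷* 0ℚ p q (suc n))
    (trans (cong (ℚ._+ coeff (p *ₚ q) n) (ℚₚ.*-zeroˡ (coeff q (suc n))))
           (ℚₚ.+-identityˡ (coeff (p *ₚ q) n)))
... | no c≢0 = inj₂ (<-rec (λ n → coeff q n ≡ 0ℚ) step)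
  where
  instance _ = ℚ.≢-nonZero c≢0
  low : ∀ n → (∀ {k} → k ℕ.< n → coeff q k ≡ 0ℚ) → coeff (0ℚ ∷ (p *ₚ q)) n ≡ 0ℚ
  low zero    _  = refl
  low (suc n) ih = coeff-*-low p q n (λ k k≤n → ih (ℕ.s≤s k≤n))
  step : ∀ n → (∀ {k} → k ℕ.< n → coeff q k ≡ 0ℚ) → coeff q n ≡ 0ℚ
  step n ih = begin
    coeff q n                                        ≡⟨ ℚₚ.*-identityˡ _ ⟨
    1ℚ ℚ.* coeff q n                                 ≡⟨ cong (ℚ._* coeff q n) (ℚₚ.*-inverseˡ c) ⟨
    (ℚ.1/ c) ℚ.* c ℚ.* coeff q n                     ≡⟨ ℚₚ.*-assoc (ℚ.1/ c) c _ ⟩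
    (ℚ.1/ c) ℚ.* (c ℚ.* coeff q n)                   ≡⟨ cong ((ℚ.1/ c) ℚ.*_) c*qₙ≡0 ⟩
    (ℚ.1/ c) ℚ.* 0ℚ                                  ≡⟨ ℚₚ.*-zeroʳ (ℚ.1/ c) ⟩
    0ℚ                                               ∎
    where
    open ≡-Reasoning
    c*qₙ≡0 : c ℚ.* coeff q n ≡ 0ℚ
    c*qₙ≡0 = begin
      c ℚ.* coeff q n                                  ≡⟨ ℚₚ.+-identityʳ _ ⟨
      c ℚ.* coeff q n ℚ.+ 0ℚ                           ≡⟨ cong (c ℚ.* coeff q n ℚ.+_) (low n ih) ⟨
      c ℚ.* coeff q n ℚ.+ coeff (0ℚ ∷ (p *ₚ q)) n      ≡⟨ coeff-∷* c p q n ⟨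
      coeff ((c ∷ p) *ₚ q) n                           ≡⟨ pq≈0 n ⟩
      0ℚ                                               ∎

-- ℚ[x][[t]], as sequences of coefficients.
PowerSeries : Set
PowerSeries = ℕ → Poly

constₛ : Poly → PowerSeries
constₛ p zero    = p
constₛ p (suc n) = []

seriesRawRing : RawRing 0ℓ 0ℓ
seriesRawRing = record
  { Carrier = PowerSeries
  ; _≈_     = λ f g → ∀ n → f n ≈ₚ g n
  ; _+_     = λ f g n → f n +ₚ g n
  ; _*_     = λ f g n → bigOp (RawRing.+-rawMonoid polyRawRing) 0 n
                                λ k → f k *ₚ g (n ∸ k)
  ; -_      = λ f n → -ₚ f n
  ; 0#      = λ _ → []
  ; 1#      = constₛ (constₚ 1ℚ)
  }

module Series where
  open RawRing seriesRawRing public using (_+_; _*_; -_; 0#; 1#)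
  open SemiringOps (RawRing.rawSemiring seriesRawRing) public using (_^_)

  infixl 6 _-_
  _-_ : PowerSeries → PowerSeries → PowerSeries
  f - g = f + (- g)

  t : PowerSeries
  t 1 = constₚ 1ℚ
  t _ = []

  -- The inverse of a series f with constant term 1, as the geometric
  -- series ∑ₖ (1 - f)^k. Since t^k divides (1 - f)^k, only the terms
  -- with k ≤ n contribute to the coefficient of t^n.
  inverse : PowerSeries → PowerSeries
  inverse f n = bigOp (RawRing.+-rawMonoid polyRawRing) 0 n
                      λ k → ((1# - f) ^ k) n

module _ where
  open Series

  generatingSeries : PowerSeries
  generatingSeries =
    (1# + t) * inverse ((1# - constₛ (constₚ (fromℕ 2) *ₚ X) * t) + t * t)

  W : ℕ → Poly
  W n = generatingSeries n

  -- W^⟨ α ⟩ n is the higher-order W_n^{(α)}, for natural α only.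
  W^⟨_⟩ : ℕ → ℕ → Poly
  W^⟨ α ⟩ n = (generatingSeries ^ α) n

-- ℚ(x), as fractions up to cross-multiplication (_≃_).
record RatFun : Set where
  constructor frac
  field
    num   : Poly
    den   : Poly
    den≉0 : ¬ (den ≈ₚ [])
open RatFun public

1≉0 : ¬ (constₚ 1ℚ ≈ₚ [])
1≉0 1≈0 with () ← 1≈0 0

X≉0 : ¬ (X ≈ₚ [])
X≉0 X≈0 with () ← X≈0 1

*-≉0 : ∀ p q → ¬ (p ≈ₚ []) → ¬ (q ≈ₚ []) → ¬ (p *ₚ q ≈ₚ [])
*-≉0 p q p≉0 q≉0 pq≈0 = [ p≉0 , q≉0 ]′ (*ₚ-noZeroDivisors p q pq≈0)

infix 4 _≃_
_≃_ : RatFun → RatFun → Set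
f ≃ g = num f *ₚ den g ≈ₚ num g *ₚ den f

ι : Poly → RatFun
ι p = frac p (constₚ 1ℚ) 1≉0

ratFunRawRing : RawRing 0ℓ 0ℓ
ratFunRawRing = record
  { Carrier = RatFun
  ; _≈_     = _≃_
  ; _+_     = λ f g → frac (num f *ₚ den g +ₚ num g *ₚ den f) (den f *ₚ den g)
                           (*-≉0 (den f) (den g) (den≉0 f) (den≉0 g))
  ; _*_     = λ f g → frac (num f *ₚ num g) (den f *ₚ den g)
                           (*-≉0 (den f) (den g) (den≉0 f) (den≉0 g))
  ; -_      = λ f → frac (-ₚ num f) (den f) (den≉0 f)
  ; 0#      = ι []
  ; 1#      = ι (constₚ 1ℚ)
  }

open RawRing ratFunRawRing public using (_*_)
open SemiringOps (RawRing.rawSemiring ratFunRawRing) using (_^_)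

∑ : ℕ → ℕ → (ℕ → RatFun) → RatFun
∑ = bigOp (RawRing.+-rawMonoid ratFunRawRing)

infixr 5 ∑ ∑[m+s+p=_]_
syntax ∑ a b (λ k → e) = ∑[ k ∈ a ⋯ b ] e

∑[m+s+p=_]_ : ℕ → (ℕ → ℕ → ℕ → RatFun) → RatFun
∑[m+s+p= n ] f = ∑[ m ∈ 0 ⋯ n ] ∑[ s ∈ 0 ⋯ n ∸ m ] f m s (n ∸ m ∸ s)

scalar : ℚ → RatFun
scalar c = ι (constₚ c)

x^_ : ℤ → RatFun
x^ (+ n)    = ι X ^ n
x^ -[1+ n ] = frac (constₚ 1ℚ) X X≉0 ^ suc n

{-# OPTIONS --safe #-}
module Submission where

-- Put F = 1/(1-2xt+t²), G = (1+t) F and ∂ = d/dt, in ℚ(x)[[t]]. The left-hand side is the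
-- coefficient of tⁿ in F^(N+1) = (1+t)^(-N-1) G^(N+1). From ∂F = 2(x-t)F² one gets by
-- induction on N that 2^N N! F^(N+1) = ∑ᵢ A i N (x-t)^(i-2N) ∂ⁱF, where
-- A (i+1) (N+1) = (2N-i-1) A (i+1) N + A i N, and unrolling this recursion in N gives the
-- nested sum a_i(N). Finally ∂^(i+1) G = (1+t) ∂^(i+1) F + (i+1) ∂ⁱF, read as a recursion for
-- ∂ⁱF, expresses it through the ∂ˡG, and the coefficients of the negative powers of x-t and
-- 1+t are binomial.

open import Algebra.Bundles using (CommutativeMonoid; CommutativeRing; RawRing)
open import Algebra.Morphism.Structures using (module RingMorphisms)
open import Algebra.Structures using (IsCommutativeRing)
open import Data.Bool.Base using (true; false)
open import Data.Fin.Base using (toℕ)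
open import Data.Integer.Base as ℤ using (ℤ; +_; -[1+_])
open import Data.List.Base using ([]; _∷_; map)
open import Data.Nat.Base as ℕ using (ℕ; zero; suc; _∸_; z≤n; s≤s; _≡ᵇ_; _!)
open import Data.Nat.Combinatorics using (_C_; nCn≡1; nCk+nC[k+1]≡[n+1]C[k+1])
open import Data.Nat.Tactic.RingSolver using () renaming (solve-∀ to ℕ-solve-∀)
open import Data.Product.Base using (_,_)
open import Data.Rational.Base as ℚ using (ℚ; 0ℚ; 1ℚ)
open import Data.Rational.Solver using (module +-*-Solver)
open import Data.Rational.Unnormalised.Base as ℚᵘ using (mkℚᵘ; *≡*)
open import Data.Sum.Base using ([_,_]′)
open import Function.Base using (id; _∘_)
open import Level using (0ℓ; _⊔_)
open import Relation.Binary.PropositionalEquality as ≡ using (_≡_)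
open import Relation.Nullary.Decidable.Core using (yes; no)
open import Relation.Nullary.Negation using (¬_; contradiction)
import Algebra.Morphism.RingMonomorphism as RingMonomorphism
import Algebra.Properties.CommutativeSemiring.Exp as Exp
import Data.Integer.Properties as ℤₚ
import Data.Nat.Properties as ℕₚ
import Data.Rational.Properties as ℚₚ
import Data.Rational.Unnormalised.Properties as ℚᵘₚ
import Relation.Binary.Reasoning.Setoid as SetoidReasoning
open import Defs hiding (_*_)

-- The field ℚ(x) is forced by 1/(x-t): as a series in t it is (1/x) · 1/(1 - t/x), and this is
-- where the negative powers of x come from. Differentiating (1-2xt+t²)F = 1 and multiplying by F
-- gives ∂F = 2(x-t)F². Hence the operator (x-t)^(-1) ∂ sends F^(N+1) to 2(N+1) F^(N+2): one
-- application is the induction step, and 2^N N! is the product of the factors collected. The same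
-- operator sends (x-t)^(i-2N) ∂ⁱF to (2N-i)(x-t)^(i-2N-2) ∂ⁱF + (x-t)^(i-2N-1) ∂^(i+1)F, which
-- explains both terms of the recursion for `A`. So `A` takes natural values; the half-integers in
-- a_i(N) arise from pulling a factor 2 out of each 2N-i. The calculations take place over abstract
-- commutative rings, where 1/(1+t), 1/(x-t) and G are known only through the equations they
-- satisfy. The ring solver in use works over commutative semirings, so these equations have their
-- negative terms moved across, and subtraction is replaced by cancelling a common summand.

module RangeSum {c ℓ} (M : CommutativeMonoid c ℓ) where
  open CommutativeMonoid M
    renaming (_∙_ to _+_; ε to 0#; ∙-cong to +-cong; ∙-congˡ to +-congˡ;
              identityˡ to +-identityˡ; identityʳ to +-identityʳ; assoc to +-assoc)
  open import Algebra.Properties.CommutativeMonoid.Sum M as Sum public using (sum)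

  ∑< : ℕ → (ℕ → Carrier) → Carrier
  ∑< n f = sum {n} (λ k → f (toℕ k))

  infixr 5 ∑<
  syntax ∑< n (λ k → e) = ∑[ k < n ] e

  ∑<-cong : ∀ n {f g : ℕ → Carrier} → (∀ k → k ℕ.< n → f k ≈ g k) → ∑< n f ≈ ∑< n g
  ∑<-cong zero    f≈g = refl
  ∑<-cong (suc n) f≈g =
    +-cong (f≈g 0 (s≤s z≤n)) (∑<-cong n (λ k k<n → f≈g (suc k) (s≤s k<n)))

  ∑<-last : ∀ n f → ∑< (suc n) f ≈ ∑< n f + f n
  ∑<-last zero    f = trans (+-identityʳ _) (sym (+-identityˡ _))
  ∑<-last (suc n) f = trans (+-congˡ (∑<-last n (f ∘ suc))) (sym (+-assoc _ _ _))

  ∑<-zero : ∀ n f → (∀ k → k ℕ.< n → f k ≈ 0#) → ∑< n f ≈ 0#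
  ∑<-zero zero    f f≈0 = refl
  ∑<-zero (suc n) f f≈0 = trans
    (+-cong (f≈0 0 (s≤s z≤n)) (∑<-zero n (f ∘ suc) (λ k k<n → f≈0 (suc k) (s≤s k<n))))
    (+-identityʳ 0#)

  ∑<-distrib-+ : ∀ n f g → ∑[ k < n ] (f k + g k) ≈ ∑< n f + ∑< n g
  ∑<-distrib-+ n f g = Sum.∑-distrib-+ {n} (f ∘ toℕ) (g ∘ toℕ)

module RingSum {c ℓ} (R : CommutativeRing c ℓ) where
  open CommutativeRing R
  open RangeSum +-commutativeMonoid public
  import Algebra.Properties.Semiring.Sum semiring as Sum

  *-distribˡ-∑< : ∀ n x f → x * ∑< n f ≈ ∑[ k < n ] (x * f k)
  *-distribˡ-∑< n x f = Sum.*-distribˡ-sum {n} x (f ∘ toℕ)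

-- Inverses characterised by fixed-point equations

module Resolvent {c ℓ} (R : CommutativeRing c ℓ) where
  open CommutativeRing R
  open SetoidReasoning setoid
  open import Algebra.Properties.Ring ring using (+-cancelʳ)
  open import Algebra.Solver.Ring.NaturalCoefficients.Default commutativeSemiring

  -- Here `g` plays the part of 1/(1-xt), and `b′` solves (1-xt) b′ = b. Expanding `g * b′` once
  -- through the equation of `b′` and once through that of `g` leaves the common summand
  -- `g * (x * (t * b′))`, which cancels.
  solution-unique : ∀ g b b′ x t → g ≈ 1# + x * (t * g) → b′ ≈ b + x * (t * b′) → g * b ≈ b′
  solution-unique g b b′ x t g≈ b′≈ = +-cancelʳ (g * (x * (t * b′))) (g * b) b′ (begin
    g * b + g * (x * (t * b′))        ≈⟨ distribˡ g b _ ⟨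
    g * (b + x * (t * b′))            ≈⟨ *-congˡ b′≈ ⟨
    g * b′                            ≈⟨ *-congʳ g≈ ⟩
    (1# + x * (t * g)) * b′
      ≈⟨ solve 4 (λ g b x t → (con 1 :+ x :* (t :* g)) :* b := b :+ g :* (x :* (t :* b)))
           refl g b′ x t ⟩
    b′ + g * (x * (t * b′))           ∎)

  -- `m` stands for -1. It is given by `m + 1# ≈ 0#` because the solver has no negation and the
  -- intended value `const (- 1#)` is not definitionally the negative of `const 1#`.
  inverse-1+t : ∀ g m t → g ≈ 1# + m * (t * g) → m + 1# ≈ 0# → g * (1# + t) ≈ 1#
  inverse-1+t g m t g≈ m+1≈0 = begin
    g * (1# + t)                     ≈⟨ solve 2 (λ g t → g :* (con 1 :+ t) := g :+ t :* g) refl g t ⟩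
    g + t * g                        ≈⟨ +-congʳ g≈ ⟩
    1# + m * (t * g) + t * g
      ≈⟨ solve 2 (λ m w → con 1 :+ m :* w :+ w := con 1 :+ (m :+ con 1) :* w) refl m (t * g) ⟩
    1# + (m + 1#) * (t * g)          ≈⟨ +-congˡ (*-congʳ m+1≈0) ⟩
    1# + 0# * (t * g)                ≈⟨ solve 1 (λ w → con 1 :+ con 0 :* w := con 1) refl (t * g) ⟩
    1#                               ∎

  inverse-x-t : ∀ x x⁻¹ g t → x * x⁻¹ ≈ 1# → g ≈ 1# + x⁻¹ * (t * g) →
                x * (x⁻¹ * g) ≈ 1# + t * (x⁻¹ * g)
  inverse-x-t x x⁻¹ g t xx⁻¹≈1 g≈ = begin
    x * (x⁻¹ * g)       ≈⟨ *-assoc x x⁻¹ g ⟨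
    x * x⁻¹ * g         ≈⟨ trans (*-congʳ xx⁻¹≈1) (*-identityˡ g) ⟩
    g                   ≈⟨ g≈ ⟩
    1# + x⁻¹ * (t * g)
      ≈⟨ solve 3 (λ x⁻¹ t g → con 1 :+ x⁻¹ :* (t :* g) := con 1 :+ t :* (x⁻¹ :* g)) refl x⁻¹ t g ⟩
    1# + t * (x⁻¹ * g)  ∎

  -- Used with w = 2xt and s = t², where it reads (1 - (1-2xt+t²)) + t² = 2xt. Adding `e` to both
  -- sides leaves only the inverse laws for the subtractions.
  complement : ∀ w s → 1# - ((1# - w) + s) + s ≈ w
  complement w s = +-cancelʳ ((1# - w) + s) _ _ (begin
    1# - e + s + e
      ≈⟨ solve 3 (λ m s e → con 1 :+ m :+ s :+ e := (m :+ e) :+ (con 1 :+ s)) refl (- e) s e ⟩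
    (- e + e) + (1# + s)    ≈⟨ +-congʳ (-‿inverseˡ e) ⟩
    0# + (1# + s)           ≈⟨ +-congʳ (-‿inverseʳ w) ⟨
    (w - w) + (1# + s)
      ≈⟨ solve 3 (λ w m s → (w :+ m) :+ (con 1 :+ s) := w :+ ((con 1 :+ m) :+ s)) refl w (- w) s ⟩
    w + e                   ∎)
    where e = (1# - w) + s

  -- With δ = 1 - (1-2xt+t²), the hypothesis on `v` says that it inverts 1-2xt+t². The conclusion is
  -- the defining equation of (1+t)/(1-2xt+t²) without a minus sign.
  resolvent-equation : ∀ δ v t w → v ≈ 1# + δ * v → δ + t * t ≈ w →
    (1# + t * t) * ((1# + t) * v) ≈ (1# + t) + w * ((1# + t) * v)
  resolvent-equation δ v t w v≈ δ+t²≈w = begin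
    (1# + t * t) * ((1# + t) * v)
      ≈⟨ solve 3 (λ t s v → (con 1 :+ t :* t) :* (s :* v) := s :* (v :+ t :* t :* v)) refl t (1# + t) v ⟩
    (1# + t) * (v + t * t * v)
      ≈⟨ *-congˡ (+-congʳ v≈) ⟩
    (1# + t) * (1# + δ * v + t * t * v)
      ≈⟨ solve 4 (λ s δ v r → s :* (con 1 :+ δ :* v :+ r :* v) := s :+ (δ :+ r) :* (s :* v)) refl
           (1# + t) δ v (t * t) ⟩
    (1# + t) + (δ + t * t) * ((1# + t) * v)
      ≈⟨ +-congˡ (*-congʳ δ+t²≈w) ⟩
    (1# + t) + w * ((1# + t) * v) ∎

-- Formal power series

module FormalSeries {c ℓ} (R : CommutativeRing c ℓ) where
  open CommutativeRing R
  open RingSum R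
  open SetoidReasoning setoid
  open import Algebra.Solver.Ring.NaturalCoefficients.Default commutativeSemiring

  Series : Set c
  Series = ℕ → Carrier

  infix 4 _≈ₛ_
  _≈ₛ_ : Series → Series → Set ℓ
  f ≈ₛ g = ∀ n → f n ≈ g n

  infixl 6 _+ₛ_
  infixl 7 _*ₛ_
  _+ₛ_ _*ₛ_ : Series → Series → Series
  (f +ₛ g) n = f n + g n
  (f *ₛ g) n = ∑[ k < suc n ] (f k * g (n ∸ k))

  -ₛ_ : Series → Series
  (-ₛ f) n = - f n

  const : Carrier → Series
  const x zero    = x
  const x (suc n) = 0#

  shift : Series → Series
  shift f n = f (suc n)

  *ₛ-cong : ∀ {f f′ g g′} → f ≈ₛ f′ → g ≈ₛ g′ → f *ₛ g ≈ₛ f′ *ₛ g′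
  *ₛ-cong f≈f′ g≈g′ n = ∑<-cong (suc n) (λ k _ → *-cong (f≈f′ k) (g≈g′ (n ∸ k)))

  -- The product unfolds definitionally along its left factor only. Peeling the right factor as well
  -- makes commutativity an induction on the degree.
  *ₛ-sucʳ : ∀ f g n → (f *ₛ g) (suc n) ≈ f (suc n) * g 0 + (f *ₛ shift g) n
  *ₛ-sucʳ f g zero    =
    solve 3 (λ a b o → a :+ (b :+ o) := b :+ (a :+ o)) refl (f 0 * g 1) (f 1 * g 0) 0#
  *ₛ-sucʳ f g (suc n) = trans (+-congˡ (*ₛ-sucʳ (shift f) g n))
    (solve 3 (λ a b o → a :+ (b :+ o) := b :+ (a :+ o)) refl
      (f 0 * g (2 ℕ.+ n)) (f (2 ℕ.+ n) * g 0) ((shift f *ₛ shift g) n))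

  *ₛ-comm : ∀ f g → f *ₛ g ≈ₛ g *ₛ f
  *ₛ-comm f g zero    = +-congʳ (*-comm (f 0) (g 0))
  *ₛ-comm f g (suc n) = trans
    (+-cong (*-comm (f 0) (g (suc n))) (*ₛ-comm (shift f) g n)) (sym (*ₛ-sucʳ g f n))

  *ₛ-distribʳ : ∀ h f g → (f +ₛ g) *ₛ h ≈ₛ (f *ₛ h) +ₛ (g *ₛ h)
  *ₛ-distribʳ h f g n = trans
    (∑<-cong (suc n) (λ k _ → distribʳ (h (n ∸ k)) (f k) (g k)))
    (∑<-distrib-+ (suc n) (λ k → f k * h (n ∸ k)) (λ k → g k * h (n ∸ k)))

  *ₛ-scale : ∀ x f g n → ((λ k → x * f k) *ₛ g) n ≈ x * (f *ₛ g) n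
  *ₛ-scale x f g n = trans
    (∑<-cong (suc n) (λ k _ → *-assoc x (f k) (g (n ∸ k))))
    (sym (*-distribˡ-∑< (suc n) x (λ k → f k * g (n ∸ k))))

  -- Induction on the degree: `shift (f *ₛ g)` is definitionally the sum of `f 0` times `shift g`
  -- and `shift f *ₛ g`, and the induction hypothesis applies to `shift f`.
  *ₛ-assoc : ∀ f g h → (f *ₛ g) *ₛ h ≈ₛ f *ₛ (g *ₛ h)
  *ₛ-assoc f g h zero    =
    solve 4 (λ a b c o → (a :* b :+ con 0) :* c :+ con 0 := a :* (b :* c :+ con 0) :+ con 0)
      refl (f 0) (g 0) (h 0) 0#
  *ₛ-assoc f g h (suc n) = begin
    (f 0 * g 0 + 0#) * h (suc n) + (shift (f *ₛ g) *ₛ h) n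
      ≈⟨ +-cong (trans (*-congʳ (+-identityʳ _)) (*-assoc _ _ _))
                (*ₛ-distribʳ h (λ k → f 0 * g (suc k)) (shift f *ₛ g) n) ⟩
    f 0 * (g 0 * h (suc n)) + (((λ k → f 0 * g (suc k)) *ₛ h) n + ((shift f *ₛ g) *ₛ h) n)
      ≈⟨ +-congˡ (+-cong (*ₛ-scale (f 0) (shift g) h n) (*ₛ-assoc (shift f) g h n)) ⟩
    f 0 * (g 0 * h (suc n)) + (f 0 * (shift g *ₛ h) n + (shift f *ₛ (g *ₛ h)) n)
      ≈⟨ solve 4 (λ a b d e → a :* b :+ (a :* d :+ e) := a :* (b :+ d) :+ e) refl
           (f 0) (g 0 * h (suc n)) ((shift g *ₛ h) n) ((shift f *ₛ (g *ₛ h)) n) ⟩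
    f 0 * (g *ₛ h) (suc n) + (shift f *ₛ (g *ₛ h)) n ∎

  const-* : ∀ x f n → (const x *ₛ f) n ≈ x * f n
  const-* x f zero    = +-identityʳ _
  const-* x f (suc n) = trans
    (+-congˡ (∑<-zero (suc n) _ (λ k _ → zeroˡ (f (n ∸ k))))) (+-identityʳ _)

  const-cong : ∀ {x y} → x ≈ y → const x ≈ₛ const y
  const-cong x≈y zero    = x≈y
  const-cong x≈y (suc n) = refl

  const-+ : ∀ x y → const (x + y) ≈ₛ const x +ₛ const y
  const-+ x y zero    = refl
  const-+ x y (suc n) = sym (+-identityʳ 0#)

  const-*-const : ∀ x y → const (x * y) ≈ₛ const x *ₛ const y
  const-*-const x y zero    = sym (const-* x (const y) 0)
  const-*-const x y (suc n) = sym (trans (const-* x (const y) (suc n)) (zeroʳ x))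

  seriesRing : CommutativeRing c ℓ
  seriesRing = record
    { Carrier = Series
    ; _≈_ = _≈ₛ_
    ; _+_ = _+ₛ_
    ; _*_ = _*ₛ_
    ; -_ = -ₛ_
    ; 0# = λ _ → 0#
    ; 1# = const 1#
    ; isCommutativeRing = record
      { isRing = record
        { +-isAbelianGroup = record
          { isGroup = record
            { isMonoid = record
              { isSemigroup = record
                { isMagma = record
                  { isEquivalence = record
                    { refl  = λ _ → refl
                    ; sym   = λ f≈g n → sym (f≈g n)
                    ; trans = λ f≈g g≈h n → trans (f≈g n) (g≈h n)
                    }
                  ; ∙-cong = λ f≈f′ g≈g′ n → +-cong (f≈f′ n) (g≈g′ n)
                  }
                ; assoc = λ f g h n → +-assoc (f n) (g n) (h n)
                }
              ; identity = (λ f n → +-identityˡ (f n)) , (λ f n → +-identityʳ (f n))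
              }
            ; inverse = (λ f n → -‿inverseˡ (f n)) , (λ f n → -‿inverseʳ (f n))
            ; ⁻¹-cong = λ f≈g n → -‿cong (f≈g n)
            }
          ; comm = λ f g n → +-comm (f n) (g n)
          }
        ; *-cong = *ₛ-cong
        ; *-assoc = *ₛ-assoc
        ; *-identity = *ₛ-identityˡ , λ f n → trans (*ₛ-comm f (const 1#) n) (*ₛ-identityˡ f n)
        ; distrib = (λ h f g n → trans (*ₛ-comm h (f +ₛ g) n)
                      (trans (*ₛ-distribʳ h f g n) (+-cong (*ₛ-comm f h n) (*ₛ-comm g h n))))
                  , *ₛ-distribʳ
        }
      ; *-comm = *ₛ-comm
      }
    }
    where
    *ₛ-identityˡ : ∀ f → const 1# *ₛ f ≈ₛ f
    *ₛ-identityˡ f n = trans (const-* 1# f n) (*-identityˡ (f n))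

  module S where
    open CommutativeRing seriesRing public
    open Exp (CommutativeRing.commutativeSemiring seriesRing) public
    open import Algebra.Properties.Semiring.Mult (CommutativeRing.semiring seriesRing) public using (_×_)

  open import Algebra.Properties.Semiring.Exp semiring using (_^_)
  open import Algebra.Properties.Semiring.Mult semiring using (_×_; ×-homo-+)

  ν : ℕ → Carrier
  ν n = n × 1#

  ν1≈1 : ν 1 ≈ 1#
  ν1≈1 = +-identityʳ 1#

  ν-+ : ∀ m n → ν (m ℕ.+ n) ≈ ν m + ν n
  ν-+ = ×-homo-+ 1#

  ∂ : Series → Series
  ∂ f n = ν (suc n) * f (suc n)

  ∂-cong : ∀ {f g} → f ≈ₛ g → ∂ f ≈ₛ ∂ g
  ∂-cong f≈g n = *-congˡ (f≈g (suc n))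

  ∂-+ : ∀ f g → ∂ (f +ₛ g) ≈ₛ ∂ f +ₛ ∂ g
  ∂-+ f g n = distribˡ _ _ _

  ∂-const : ∀ x n → ∂ (const x) n ≈ 0#
  ∂-const x n = zeroʳ _

  -- The Euler operator t·∂ is diagonal, so its product rule holds termwise; ∂ is its shift.
  ∂-* : ∀ f g → ∂ (f *ₛ g) ≈ₛ (∂ f *ₛ g) +ₛ (f *ₛ ∂ g)
  ∂-* f g n = begin
    ν (suc n) * (f *ₛ g) (suc n)
      ≈⟨ euler (suc n) ⟩
    (0# * f 0 * g (suc n) + (∂ f *ₛ g) n) + (f *ₛ θ g) (suc n)
      ≈⟨ +-congˡ (*ₛ-sucʳ f (θ g) n) ⟩
    (0# * f 0 * g (suc n) + (∂ f *ₛ g) n) + (f (suc n) * (0# * g 0) + (f *ₛ ∂ g) n)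
      ≈⟨ solve 6 (λ a b c d p q → ((con 0 :* a :* b :+ p) :+ (c :* (con 0 :* d) :+ q)) := p :+ q)
           refl (f 0) (g (suc n)) (f (suc n)) (g 0) ((∂ f *ₛ g) n) ((f *ₛ ∂ g) n) ⟩
    (∂ f *ₛ g) n + (f *ₛ ∂ g) n ∎
    where
    θ : Series → Series
    θ f n = ν n * f n
    term : ∀ n k → k ℕ.≤ n →
           ν n * (f k * g (n ∸ k)) ≈ ν k * f k * g (n ∸ k) + f k * (ν (n ∸ k) * g (n ∸ k))
    term n k k≤n = begin
      ν n * (f k * g (n ∸ k))
        ≡⟨ ≡.cong (λ m → ν m * (f k * g (n ∸ k))) (ℕₚ.m+[n∸m]≡n k≤n) ⟨
      ν (k ℕ.+ (n ∸ k)) * (f k * g (n ∸ k))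
        ≈⟨ *-congʳ (ν-+ k (n ∸ k)) ⟩
      (ν k + ν (n ∸ k)) * (f k * g (n ∸ k))
        ≈⟨ solve 4 (λ a b c d → (a :+ b) :* (c :* d) := a :* c :* d :+ c :* (b :* d)) refl
             (ν k) (ν (n ∸ k)) (f k) (g (n ∸ k)) ⟩
      ν k * f k * g (n ∸ k) + f k * (ν (n ∸ k) * g (n ∸ k)) ∎
    euler : ∀ n → ν n * (f *ₛ g) n ≈ (θ f *ₛ g) n + (f *ₛ θ g) n
    euler n = begin
      ν n * (f *ₛ g) n
        ≈⟨ *-distribˡ-∑< (suc n) (ν n) (λ k → f k * g (n ∸ k)) ⟩
      (∑[ k < suc n ] (ν n * (f k * g (n ∸ k))))
        ≈⟨ ∑<-cong (suc n) (λ k k<1+n → term n k (ℕₚ.≤-pred k<1+n)) ⟩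
      (∑[ k < suc n ] (θ f k * g (n ∸ k) + f k * θ g (n ∸ k)))
        ≈⟨ ∑<-distrib-+ (suc n) (λ k → θ f k * g (n ∸ k)) (λ k → f k * θ g (n ∸ k)) ⟩
      (θ f *ₛ g) n + (f *ₛ θ g) n ∎

  t : Series
  t zero    = 0#
  t (suc n) = const 1# n

  t-* : ∀ f n → (t *ₛ f) (suc n) ≈ f n
  t-* f n = trans (+-cong (zeroˡ _) (trans (const-* 1# f n) (*-identityˡ _))) (+-identityˡ _)

  ∂-t : ∂ t ≈ₛ const 1#
  ∂-t zero    = trans (*-identityʳ _) ν1≈1
  ∂-t (suc n) = zeroʳ _

  geometric : Carrier → Series
  geometric x n = x ^ n

  -- The expansion of (1-xt)^(-k-1), as `geometric-^` confirms.
  binomialSeries : Carrier → ℕ → Series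
  binomialSeries x k n = ν ((k ℕ.+ n) C n) * x ^ n

  const-^ : ∀ x k → const x S.^ k ≈ₛ const (x ^ k)
  const-^ x zero    = S.refl {const 1#}
  const-^ x (suc k) = S.trans (S.*-congˡ {const x} (const-^ x k)) (S.sym (const-*-const x (x ^ k)))

  ∑<ₛ-coefficient : ∀ m (g : ℕ → Series) n → RingSum.∑< seriesRing m g n ≈ ∑[ k < m ] (g k n)
  ∑<ₛ-coefficient zero    g n = refl
  ∑<ₛ-coefficient (suc m) g n = +-congˡ (∑<ₛ-coefficient m (g ∘ suc) n)

  ×1-const : ∀ k → k S.× const 1# ≈ₛ const (ν k)
  ×1-const zero    zero    = refl
  ×1-const zero    (suc n) = refl
  ×1-const (suc k) = S.trans (S.+-congˡ {const 1#} (×1-const k)) (S.sym (const-+ 1# (ν k)))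

  -- Numerals of the series ring are iterated sums `k S.× const 1#`, not constant series by
  -- definition. This passes from them to scalars of the base ring.
  ×1-coefficient : ∀ k f n → ((k S.× const 1#) *ₛ f) n ≈ ν k * f n
  ×1-coefficient k f n = trans (S.*-congʳ {f} (×1-const k) n) (const-* (ν k) f n)

  geometric-unfold : ∀ x → geometric x ≈ₛ const 1# +ₛ const x *ₛ (t *ₛ geometric x)
  geometric-unfold x zero = sym (begin
    1# + (x * (0# * 1# + 0#) + 0#)
      ≈⟨ solve 1 (λ x → con 1 :+ (x :* (con 0 :* con 1 :+ con 0) :+ con 0) := con 1) refl x ⟩
    1# ∎)
  geometric-unfold x (suc n) = sym (trans (+-identityˡ _)
    (trans (const-* x (t *ₛ geometric x) (suc n)) (*-congˡ (t-* (geometric x) n))))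

  -- Pascal's rule, read as (1-xt) · (1-xt)^(-k-2) = (1-xt)^(-k-1).
  binomialSeries-unfold : ∀ x k → binomialSeries x (suc k) ≈ₛ
    binomialSeries x k +ₛ const x *ₛ (t *ₛ binomialSeries x (suc k))
  binomialSeries-unfold x k zero    = sym (begin
    ν 1 * 1# + (x * (0# * (ν 1 * 1#) + 0#) + 0#)
      ≈⟨ solve 2 (λ x v → v :+ (x :* (con 0 :* v :+ con 0) :+ con 0) := v) refl x (ν 1 * 1#) ⟩
    ν 1 * 1# ∎)
  binomialSeries-unfold x k (suc n) = sym (begin
    ν (k+1+n C suc n) * (x * x ^ n) + (const x *ₛ (t *ₛ binomialSeries x (suc k))) (suc n)
      ≈⟨ +-congˡ (trans (const-* x (t *ₛ binomialSeries x (suc k)) (suc n))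
                        (*-congˡ (t-* (binomialSeries x (suc k)) n))) ⟩
    ν (k+1+n C suc n) * (x * x ^ n) + x * (ν ((suc k ℕ.+ n) C n) * x ^ n)
      ≈⟨ solve 4 (λ a b c d → a :* (b :* c) :+ b :* (d :* c) := (d :+ a) :* (b :* c)) refl
           (ν (k+1+n C suc n)) x (x ^ n) (ν ((suc k ℕ.+ n) C n)) ⟩
    (ν ((suc k ℕ.+ n) C n) + ν (k+1+n C suc n)) * (x * x ^ n)
      ≈⟨ *-congʳ (ν-+ ((suc k ℕ.+ n) C n) (k+1+n C suc n)) ⟨
    ν ((suc k ℕ.+ n) C n ℕ.+ k+1+n C suc n) * (x * x ^ n)
      ≡⟨ ≡.cong (λ m → ν m * (x * x ^ n)) pascal ⟩
    ν ((suc k ℕ.+ suc n) C suc n) * (x * x ^ n) ∎)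
    where
    k+1+n = k ℕ.+ suc n
    pascal : (suc k ℕ.+ n) C n ℕ.+ k+1+n C suc n ≡ suc k+1+n C suc n
    pascal = ≡.trans (≡.cong (λ m → m C n ℕ.+ k+1+n C suc n) (≡.sym (ℕₚ.+-suc k n)))
                     (nCk+nC[k+1]≡[n+1]C[k+1] k+1+n n)

  -- In the induction step the power and the binomial series both solve (1-xt) b′ = b with b the
  -- previous binomial series, so `solution-unique` identifies them.
  geometric-^ : ∀ x k → geometric x S.^ suc k ≈ₛ binomialSeries x k
  geometric-^ x zero n = trans (S.*-identityʳ (geometric x) n) (sym (begin
    ν (n C n) * x ^ n  ≡⟨ ≡.cong (λ m → ν m * x ^ n) (nCn≡1 n) ⟩
    ν 1 * x ^ n        ≈⟨ *-congʳ ν1≈1 ⟩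
    1# * x ^ n         ≈⟨ *-identityˡ _ ⟩
    x ^ n              ∎))
  geometric-^ x (suc k) = S.trans (S.*-congˡ {geometric x} (geometric-^ x k))
    (Resolvent.solution-unique seriesRing (geometric x) (binomialSeries x k)
      (binomialSeries x (suc k)) (const x) t (geometric-unfold x) (binomialSeries-unfold x k))

  partialSum : Series → ℕ → Series
  partialSum f m n = ∑[ k < m ] ((f S.^ k) n)

  -- The sum of all powers of `f`, cut off at degree `n` exactly as in `Series.inverse`. The cut-off
  -- varies with the coefficient, so the fixed-point equation needs the stability of the partial
  -- sums.
  neumann : Series → Series
  neumann f n = partialSum f (suc n) n

  *ₛ-∑< : ∀ f m (g : ℕ → Series) →
          f *ₛ (λ n → ∑[ k < m ] (g k n)) ≈ₛ (λ n → ∑[ k < m ] ((f *ₛ g k) n))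
  *ₛ-∑< f zero    g = S.zeroʳ f
  *ₛ-∑< f (suc m) g n = trans (S.distribˡ f (g 0) (λ j → ∑[ k < m ] (g (suc k) j)) n)
                              (+-congˡ (*ₛ-∑< f m (g ∘ suc) n))

  module _ (f : Series) (f₀≈0 : f 0 ≈ 0#) where

    -- t divides `f`, hence t^k divides the k-th power of `f`.
    ^-low : ∀ k n → n ℕ.< k → (f S.^ k) n ≈ 0#
    ^-low (suc k) zero    _         = trans (+-identityʳ _) (trans (*-congʳ f₀≈0) (zeroˡ _))
    ^-low (suc k) (suc n) (s≤s n<k) = trans
      (+-cong (trans (*-congʳ f₀≈0) (zeroˡ _))
              (∑<-zero (suc n) _ (λ j _ → trans
                (*-congˡ {f (suc j)} (^-low k (n ∸ j) (ℕₚ.≤-<-trans (ℕₚ.m∸n≤m n j) n<k))) (zeroʳ _))))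
      (+-identityʳ 0#)

    partialSum-stable : ∀ j n → partialSum f (j ℕ.+ suc n) n ≈ neumann f n
    partialSum-stable zero    n = refl
    partialSum-stable (suc j) n = trans (∑<-last (j ℕ.+ suc n) (λ k → (f S.^ k) n))
      (trans (+-cong (partialSum-stable j n) (^-low (j ℕ.+ suc n) n (ℕₚ.m≤n+m (suc n) j)))
             (+-identityʳ _))

    neumann-unfold : neumann f ≈ₛ const 1# +ₛ f *ₛ neumann f
    neumann-unfold zero = +-congˡ (sym
      (trans (+-identityʳ _) (trans (*-congʳ f₀≈0) (zeroˡ _))))
    neumann-unfold (suc n) = +-congˡ (begin
      (∑[ k < suc n ] ((f *ₛ (f S.^ k)) (suc n)))
        ≈⟨ *ₛ-∑< f (suc n) (λ k → f S.^ k) (suc n) ⟨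
      f 0 * partialSum f (suc n) (suc n) + (shift f *ₛ partialSum f (suc n)) n
        -- In degree `suc n` the partial sum with `suc n` terms is one term short of `neumann f`,
        -- but there it is multiplied by `f 0 ≈ 0#`. All other coefficients that occur have degree
        -- at most `n` and are already stable.
        ≈⟨ +-cong (trans (*-congʳ f₀≈0) (trans (zeroˡ _) (sym (trans (*-congʳ f₀≈0) (zeroˡ _)))))
                  (∑<-cong (suc n) (λ k k≤n → *-congˡ {f (suc k)} (stable k (ℕₚ.≤-pred k≤n)))) ⟩
      f 0 * neumann f (suc n) + (shift f *ₛ neumann f) n ∎)
      where
      stable : ∀ k → k ℕ.≤ n → partialSum f (suc n) (n ∸ k) ≈ neumann f (n ∸ k)
      stable k k≤n = begin
        partialSum f (suc n) (n ∸ k)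
          ≡⟨ ≡.cong (λ m → partialSum f m (n ∸ k))
               (≡.trans (ℕₚ.+-suc k (n ∸ k)) (≡.cong suc (ℕₚ.m+[n∸m]≡n k≤n))) ⟨
        partialSum f (k ℕ.+ suc (n ∸ k)) (n ∸ k)
          ≈⟨ partialSum-stable k (n ∸ k) ⟩
        neumann f (n ∸ k) ∎

-- Derivatives of 1/(1-2xt+t²)

-- ∑ᵢ A i N (x-t)^(i-2N) ∂ⁱF = 2^N N! F^(N+1) for F = 1/(1-2xt+t²). The subtraction is
-- truncated only where A (suc i) N = 0.
A : ℕ → ℕ → ℕ
A zero    zero    = 1
A (suc i) zero    = 0
A zero    (suc N) = 2 ℕ.* N ℕ.* A zero N
A (suc i) (suc N) = (2 ℕ.* N ∸ suc i) ℕ.* A (suc i) N ℕ.+ A i N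

A-outside : ∀ i N → N ℕ.< i → A i N ≡ 0
A-outside (suc i) zero    _         = ≡.refl
A-outside (suc i) (suc N) (s≤s N<i) = ≡.cong₂ ℕ._+_
  (≡.trans (≡.cong ((2 ℕ.* N ∸ suc i) ℕ.*_) (A-outside (suc i) N (ℕₚ.m≤n⇒m≤1+n N<i)))
           (ℕₚ.*-zeroʳ (2 ℕ.* N ∸ suc i)))
  (A-outside i N N<i)

record IsDerivation {c ℓ} (S : CommutativeRing c ℓ)
  (∂ : CommutativeRing.Carrier S → CommutativeRing.Carrier S) : Set (c ⊔ ℓ) where
  open CommutativeRing S
  field
    ∂-cong : ∀ {f g} → f ≈ g → ∂ f ≈ ∂ g
    ∂-+    : ∀ f g → ∂ (f + g) ≈ ∂ f + ∂ g
    ∂-*    : ∀ f g → ∂ (f * g) ≈ ∂ f * g + f * ∂ g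

module Derivation {c ℓ} (S : CommutativeRing c ℓ)
  (∂ : CommutativeRing.Carrier S → CommutativeRing.Carrier S) (∂-isDerivation : IsDerivation S ∂)
  where

  open CommutativeRing S
  open IsDerivation ∂-isDerivation
  open RingSum S
  open SetoidReasoning setoid
  open import Algebra.Solver.Ring.NaturalCoefficients.Default commutativeSemiring
  open import Algebra.Properties.Ring ring using (+-cancelʳ)
  open import Algebra.Properties.CommutativeSemiring.Exp commutativeSemiring using (_^_; ^-distrib-*)
  open import Algebra.Properties.Semiring.Mult semiring using (_×_; ×-homo-+; ×1-homo-*)

  ν : ℕ → Carrier
  ν n = n × 1#

  ν-+ : ∀ m n → ν (m ℕ.+ n) ≈ ν m + ν n
  ν-+ = ×-homo-+ 1#

  ν-* : ∀ m n → ν (m ℕ.* n) ≈ ν m * ν n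
  ν-* = ×1-homo-*

  ∂0≈0 : ∂ 0# ≈ 0#
  ∂0≈0 = +-cancelʳ (∂ 0#) (∂ 0#) 0# (begin
    ∂ 0# + ∂ 0#  ≈⟨ ∂-+ 0# 0# ⟨
    ∂ (0# + 0#)  ≈⟨ ∂-cong (+-identityˡ 0#) ⟩
    ∂ 0#         ≈⟨ +-identityˡ (∂ 0#) ⟨
    0# + ∂ 0#    ∎)

  ∂1≈0 : ∂ 1# ≈ 0#
  ∂1≈0 = +-cancelʳ (∂ 1#) (∂ 1#) 0# (begin
    ∂ 1# + ∂ 1#            ≈⟨ +-cong (*-identityʳ _) (*-identityˡ _) ⟨
    ∂ 1# * 1# + 1# * ∂ 1#  ≈⟨ ∂-* 1# 1# ⟨
    ∂ (1# * 1#)            ≈⟨ ∂-cong (*-identityˡ 1#) ⟩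
    ∂ 1#                   ≈⟨ +-identityˡ (∂ 1#) ⟨
    0# + ∂ 1#              ∎)

  ∂-ν : ∀ n → ∂ (ν n) ≈ 0#
  ∂-ν zero    = ∂0≈0
  ∂-ν (suc n) = trans (∂-+ 1# (ν n)) (trans (+-cong ∂1≈0 (∂-ν n)) (+-identityˡ 0#))

  ∂-scale : ∀ {z} → ∂ z ≈ 0# → ∀ f → ∂ (z * f) ≈ z * ∂ f
  ∂-scale {z} ∂z≈0 f = begin
    ∂ (z * f)          ≈⟨ ∂-* z f ⟩
    ∂ z * f + z * ∂ f  ≈⟨ +-congʳ (trans (*-congʳ ∂z≈0) (zeroˡ f)) ⟩
    0# + z * ∂ f       ≈⟨ +-identityˡ _ ⟩
    z * ∂ f            ∎

  ∂-∑< : ∀ n (f : ℕ → Carrier) → ∂ (∑< n f) ≈ ∑[ k < n ] (∂ (f k))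
  ∂-∑< zero    f = ∂0≈0
  ∂-∑< (suc n) f = trans (∂-+ (f 0) _) (+-congˡ (∂-∑< n (f ∘ suc)))

  ∂-^ : ∀ f k → ∂ (f ^ suc k) ≈ ν (suc k) * (f ^ k * ∂ f)
  ∂-^ f zero = begin
    ∂ (f * 1#)             ≈⟨ ∂-cong (*-identityʳ f) ⟩
    ∂ f                    ≈⟨ solve 1 (λ a → a := (con 1 :+ con 0) :* (con 1 :* a)) refl (∂ f) ⟩
    ν 1 * (1# * ∂ f)       ∎
  ∂-^ f (suc k) = begin
    ∂ (f * f ^ suc k)                                        ≈⟨ ∂-* f (f ^ suc k) ⟩
    ∂ f * (f * f ^ k) + f * ∂ (f ^ suc k)                    ≈⟨ +-congˡ (*-congˡ (∂-^ f k)) ⟩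
    ∂ f * (f * f ^ k) + f * (ν (suc k) * (f ^ k * ∂ f))
      ≈⟨ solve 4 (λ d f p n → d :* (f :* p) :+ f :* (n :* (p :* d)) := (con 1 :+ n) :* (f :* p :* d))
           refl (∂ f) f (f ^ k) (ν (suc k)) ⟩
    ν (2 ℕ.+ k) * (f ^ suc k * ∂ f) ∎

  ∂^ : ℕ → Carrier → Carrier
  ∂^ zero    f = f
  ∂^ (suc i) f = ∂ (∂^ i f)

  -- `u` is 1/(1+t), `y` is 1/(x-t), and `G` is (1+t)/(1-2xt+t²). Apart from the derivation laws,
  -- these equations are all that the differential part uses.
  module Expansion
    (x t u y G : Carrier)
    (∂x≈0 : ∂ x ≈ 0#) (∂t≈1 : ∂ t ≈ 1#)
    (u-inverse : u * (1# + t) ≈ 1#)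
    (y-inverse : x * y ≈ 1# + t * y)
    (G-equation : (1# + t * t) * G ≈ (1# + t) + ν 2 * (x * t) * G)
    where

    F Z : Carrier
    F = u * G
    Z = x - t

    Z+t≈x : Z + t ≈ x
    Z+t≈x = trans (+-assoc x (- t) t) (trans (+-congˡ (-‿inverseˡ t)) (+-identityʳ x))

    yZ≈1 : y * Z ≈ 1#
    yZ≈1 = +-cancelʳ (t * y) (y * Z) 1# (begin
      y * Z + t * y  ≈⟨ solve 3 (λ y z t → y :* z :+ t :* y := (z :+ t) :* y) refl y Z t ⟩
      (Z + t) * y    ≈⟨ *-congʳ Z+t≈x ⟩
      x * y          ≈⟨ y-inverse ⟩
      1# + t * y     ∎)

    ∂Z+1≈0 : ∂ Z + 1# ≈ 0#
    ∂Z+1≈0 = begin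
      ∂ Z + 1#   ≈⟨ +-congˡ ∂t≈1 ⟨
      ∂ Z + ∂ t  ≈⟨ ∂-+ Z t ⟨
      ∂ (Z + t)  ≈⟨ ∂-cong Z+t≈x ⟩
      ∂ x        ≈⟨ ∂x≈0 ⟩
      0#         ∎

    -- Differentiate `y * Z ≈ 1#`, multiply by `y`, and insert ∂Z = -1, available in the form
    -- `∂Z+1≈0`.
    ∂y≈y² : ∂ y ≈ y * y
    ∂y≈y² = +-cancelʳ (∂ Z * y * y) (∂ y) (y * y) (begin
      ∂ y + ∂ Z * y * y
        ≈⟨ +-congʳ (*-identityʳ (∂ y)) ⟨
      ∂ y * 1# + ∂ Z * y * y
        ≈⟨ +-congʳ (*-congˡ yZ≈1) ⟨
      ∂ y * (y * Z) + ∂ Z * y * y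
        ≈⟨ solve 4 (λ dy y z dz → dy :* (y :* z) :+ dz :* y :* y := y :* (dy :* z :+ y :* dz))
             refl (∂ y) y Z (∂ Z) ⟩
      y * (∂ y * Z + y * ∂ Z)
        ≈⟨ *-congˡ (∂-* y Z) ⟨
      y * ∂ (y * Z)
        ≈⟨ *-congˡ (trans (∂-cong yZ≈1) ∂1≈0) ⟩
      y * 0#
        ≈⟨ solve 1 (λ y → y :* con 0 := con 0 :* y :* y) refl y ⟩
      0# * y * y
        ≈⟨ *-congʳ (*-congʳ ∂Z+1≈0) ⟨
      (∂ Z + 1#) * y * y
        ≈⟨ solve 2 (λ dz y → (dz :+ con 1) :* y :* y := y :* y :+ dz :* y :* y) refl (∂ Z) y ⟩
      y * y + ∂ Z * y * y ∎)

    ∂y^ : ∀ k → ∂ (y ^ k) ≈ ν k * y ^ suc k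
    ∂y^ zero    = trans ∂1≈0 (sym (zeroˡ _))
    ∂y^ (suc k) = trans (∂-^ y k) (*-congˡ (trans (*-congˡ ∂y≈y²)
      (solve 2 (λ p y → p :* (y :* y) := y :* (y :* p)) refl (y ^ k) y)))

    F-equation : (1# + t * t) * F ≈ 1# + ν 2 * (x * t) * F
    F-equation = begin
      (1# + t * t) * (u * G)
        ≈⟨ solve 3 (λ a u g → a :* (u :* g) := u :* (a :* g)) refl (1# + t * t) u G ⟩
      u * ((1# + t * t) * G)
        ≈⟨ *-congˡ G-equation ⟩
      u * ((1# + t) + ν 2 * (x * t) * G)
        ≈⟨ solve 4 (λ u s a g → u :* (s :+ a :* g) := u :* s :+ a :* (u :* g)) refl
             u (1# + t) (ν 2 * (x * t)) G ⟩
      u * (1# + t) + ν 2 * (x * t) * (u * G)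
        ≈⟨ +-congʳ u-inverse ⟩
      1# + ν 2 * (x * t) * F ∎

    -- The derivative of `F-equation`. Writing x = Z + t splits 2xF into 2ZF and 2tF, and 2tF
    -- cancels against the derivative of t² times F; this is how the factor x - t arises.
    ∂F-equation : (1# + t * t) * ∂ F ≈ ν 2 * Z * F + ν 2 * (x * t) * ∂ F
    ∂F-equation = +-cancelʳ (ν 2 * t * F) _ _ (begin
      (1# + t * t) * ∂ F + ν 2 * t * F
        ≈⟨ solve 3 (λ t f df → (con 1 :+ t :* t) :* df :+ (con 1 :+ (con 1 :+ con 0)) :* t :* f
                     := (con 0 :+ (con 1 :* t :+ t :* con 1)) :* f :+ (con 1 :+ t :* t) :* df)
             refl t F (∂ F) ⟩
      (0# + (1# * t + t * 1#)) * F + (1# + t * t) * ∂ F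
        ≈⟨ +-congʳ (*-congʳ ∂[1+t²]) ⟨
      ∂ (1# + t * t) * F + (1# + t * t) * ∂ F
        ≈⟨ ∂-* (1# + t * t) F ⟨
      ∂ ((1# + t * t) * F)
        ≈⟨ ∂-cong F-equation ⟩
      ∂ (1# + ν 2 * (x * t) * F)
        ≈⟨ ∂-+ 1# (ν 2 * (x * t) * F) ⟩
      ∂ 1# + ∂ (ν 2 * (x * t) * F)
        ≈⟨ +-cong ∂1≈0 (trans (∂-* (ν 2 * (x * t)) F) (+-congʳ (*-congʳ ∂[2xt]))) ⟩
      0# + (ν 2 * (x * 1#) * F + ν 2 * (x * t) * ∂ F)
        ≈⟨ +-congˡ (+-congʳ (*-congʳ (*-congˡ (*-congʳ Z+t≈x)))) ⟨
      0# + (ν 2 * ((Z + t) * 1#) * F + ν 2 * (x * t) * ∂ F)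
        ≈⟨ solve 6 (λ n z t f x df → con 0 :+ (n :* ((z :+ t) :* con 1) :* f :+ n :* (x :* t) :* df)
                     := n :* z :* f :+ n :* (x :* t) :* df :+ n :* t :* f)
             refl (ν 2) Z t F x (∂ F) ⟩
      ν 2 * Z * F + ν 2 * (x * t) * ∂ F + ν 2 * t * F ∎)
      where
      ∂[1+t²] : ∂ (1# + t * t) ≈ 0# + (1# * t + t * 1#)
      ∂[1+t²] = trans (∂-+ 1# (t * t))
        (+-cong ∂1≈0 (trans (∂-* t t) (+-cong (*-congʳ ∂t≈1) (*-congˡ ∂t≈1))))
      ∂[2xt] : ∂ (ν 2 * (x * t)) ≈ ν 2 * (x * 1#)
      ∂[2xt] = trans (∂-scale (∂-ν 2) (x * t)) (*-congˡ (trans (∂-scale ∂x≈0 t) (*-congˡ ∂t≈1)))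

    -- `∂F-equation` says (1-2xt+t²) ∂F = 2ZF. Multiplication by F turns its left-hand side into ∂F,
    -- since (1-2xt+t²)F = 1.
    ∂F≈2ZF² : ∂ F ≈ ν 2 * Z * (F * F)
    ∂F≈2ZF² = +-cancelʳ (ν 2 * (x * t) * F * ∂ F) _ _ (begin
      ∂ F + ν 2 * (x * t) * F * ∂ F
        ≈⟨ solve 2 (λ a df → df :+ a :* df := (con 1 :+ a) :* df) refl (ν 2 * (x * t) * F) (∂ F) ⟩
      (1# + ν 2 * (x * t) * F) * ∂ F
        ≈⟨ *-congʳ F-equation ⟨
      (1# + t * t) * F * ∂ F
        ≈⟨ solve 3 (λ a f df → a :* f :* df := f :* (a :* df)) refl (1# + t * t) F (∂ F) ⟩
      F * ((1# + t * t) * ∂ F)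
        ≈⟨ *-congˡ ∂F-equation ⟩
      F * (ν 2 * Z * F + ν 2 * (x * t) * ∂ F)
        ≈⟨ solve 4 (λ f a b df → f :* (a :* f :+ b :* df) := a :* (f :* f) :+ b :* f :* df)
             refl F (ν 2 * Z) (ν 2 * (x * t)) (∂ F) ⟩
      ν 2 * Z * (F * F) + ν 2 * (x * t) * F * ∂ F ∎)

    summand : ℕ → ℕ → Carrier
    summand N i = ν (A i N) * (y ^ (2 ℕ.* N ∸ i) * ∂^ i F)

    private
      -- The two halves of `y * ∂ (summand N i)`: in `P` the derivative falls on the power of `y`
      -- and the index stays `i`; in `Q` it falls on ∂ⁱF and the index moves to `suc i`.
      P Q : ℕ → ℕ → Carrier
      P N i = ν (A i N) * (ν (2 ℕ.* N ∸ i) * (y ^ (2 ℕ.+ (2 ℕ.* N ∸ i)) * ∂^ i F))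
      Q N i = ν (A i N) * (y ^ (1 ℕ.+ (2 ℕ.* N ∸ i)) * ∂^ (suc i) F)

      2*suc∸suc : ∀ N i → i ℕ.≤ N → 2 ℕ.* suc N ∸ suc i ≡ 1 ℕ.+ (2 ℕ.* N ∸ i)
      2*suc∸suc N i i≤N = ≡.trans (≡.cong (_∸ suc i) (ℕₚ.*-suc 2 N))
        (ℕₚ.+-∸-assoc 1 (ℕₚ.≤-trans i≤N (ℕₚ.m≤n*m N 2)))

      2*suc∸ : ∀ N i → i ℕ.≤ N → 2 ℕ.* suc N ∸ i ≡ 2 ℕ.+ (2 ℕ.* N ∸ i)
      2*suc∸ N i i≤N = ≡.trans (≡.cong (_∸ i) (ℕₚ.*-suc 2 N))
        (ℕₚ.+-∸-assoc 2 (ℕₚ.≤-trans i≤N (ℕₚ.m≤n*m N 2)))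

      y∂-summand : ∀ N i → y * ∂ (summand N i) ≈ P N i + Q N i
      y∂-summand N i = begin
        y * ∂ (ν Aᵢ * (y ^ e * Fᵢ))
          ≈⟨ *-congˡ (trans (∂-scale (∂-ν Aᵢ) _) (*-congˡ (∂-* (y ^ e) Fᵢ))) ⟩
        y * (ν Aᵢ * (∂ (y ^ e) * Fᵢ + y ^ e * ∂ Fᵢ))
          ≈⟨ *-congˡ (*-congˡ (+-congʳ (*-congʳ (∂y^ e)))) ⟩
        y * (ν Aᵢ * (ν e * (y * y ^ e) * Fᵢ + y ^ e * ∂ Fᵢ))
          ≈⟨ solve 6 (λ y a e p f df → y :* (a :* (e :* (y :* p) :* f :+ p :* df))
                        := a :* (e :* ((y :* (y :* p)) :* f)) :+ a :* ((y :* p) :* df))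
               refl y (ν Aᵢ) (ν e) (y ^ e) Fᵢ (∂ Fᵢ) ⟩
        P N i + Q N i ∎
        where
        Aᵢ = A i N
        e  = 2 ℕ.* N ∸ i
        Fᵢ = ∂^ i F

      P-outside : ∀ N i → N ℕ.< i → P N i ≈ 0#
      P-outside N i N<i = trans
        (*-congʳ (reflexive (≡.cong ν (A-outside i N N<i)))) (zeroˡ _)

      summand-zero : ∀ N → summand (suc N) 0 ≈ P N 0
      summand-zero N = begin
        ν (2 ℕ.* N ℕ.* A 0 N) * (y ^ (2 ℕ.* suc N) * F)
          ≈⟨ *-cong (ν-* (2 ℕ.* N) (A 0 N))
                    (*-congʳ (reflexive (≡.cong (y ^_) (2*suc∸ N 0 z≤n)))) ⟩
        ν (2 ℕ.* N) * ν (A 0 N) * (y ^ (2 ℕ.+ 2 ℕ.* N) * F)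
          ≈⟨ solve 3 (λ a b c → a :* b :* c := b :* (a :* c)) refl _ _ _ ⟩
        P N 0 ∎

      summand-suc : ∀ N i → i ℕ.≤ N → summand (suc N) (suc i) ≈ P N (suc i) + Q N i
      summand-suc N i i≤N = begin
        ν (e ℕ.* A (suc i) N ℕ.+ A i N) * (y ^ (2 ℕ.* suc N ∸ suc i) * F′)
          ≈⟨ *-congʳ (trans (ν-+ (e ℕ.* A (suc i) N) (A i N)) (+-congʳ (ν-* e (A (suc i) N)))) ⟩
        (ν e * ν (A (suc i) N) + ν (A i N)) * (y ^ (2 ℕ.* suc N ∸ suc i) * F′)
          ≈⟨ solve 4 (λ a b c d → (a :* b :+ c) :* d := b :* (a :* d) :+ c :* d)
               refl (ν e) (ν (A (suc i) N)) (ν (A i N)) (y ^ (2 ℕ.* suc N ∸ suc i) * F′) ⟩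
        ν (A (suc i) N) * (ν e * (y ^ (2 ℕ.* suc N ∸ suc i) * F′))
          + ν (A i N) * (y ^ (2 ℕ.* suc N ∸ suc i) * F′)
          ≈⟨ +-cong P-part (*-congˡ (*-congʳ (reflexive (≡.cong (y ^_) (2*suc∸suc N i i≤N))))) ⟩
        P N (suc i) + Q N i ∎
        where
        e  = 2 ℕ.* N ∸ suc i
        F′ = ∂^ (suc i) F
        P-part : ν (A (suc i) N) * (ν e * (y ^ (2 ℕ.* suc N ∸ suc i) * F′)) ≈ P N (suc i)
        -- The exponents are compared under `suc i ≤ N`, which rules out truncation. Beyond that
        -- range `A (suc i) N` is zero and both sides vanish.
        P-part with suc i ℕₚ.≤? N
        ... | yes i<N = *-congˡ (*-congˡ (*-congʳ (reflexive (≡.cong (y ^_) (2*suc∸ N (suc i) i<N)))))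
        ... | no  i≮N = trans
          (trans (*-congʳ (reflexive (≡.cong ν (A-outside (suc i) N (ℕₚ.≰⇒> i≮N))))) (zeroˡ _))
          (sym (P-outside N (suc i) (ℕₚ.≰⇒> i≮N)))

    -- By ∂F = 2ZF² the derivative of F^(N+1) is 2(N+1) Z F^(N+2), and `y` cancels `Z`. So `y * ∂`
    -- takes the identity for `N` to the one for `suc N`; inserting `y * Z` for 1 starts the
    -- calculation.
    power-expansion : ∀ N → ν (2 ℕ.^ N ℕ.* N !) * F ^ suc N ≈ ∑[ i < suc N ] (summand N i)
    power-expansion zero = solve 1 (λ f → (con 1 :+ con 0) :* (f :* con 1)
      := (con 1 :+ con 0) :* (con 1 :* f) :+ con 0) refl F
    power-expansion (suc N) = begin
      ν (2 ℕ.^ suc N ℕ.* suc N !) * F ^ (2 ℕ.+ N)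
        ≈⟨ *-congʳ ν-factor ⟩
      ν c′ * ν (suc N) * ν 2 * (F * (F * F ^ N))
        ≈⟨ *-identityˡ _ ⟨
      1# * (ν c′ * ν (suc N) * ν 2 * (F * (F * F ^ N)))
        ≈⟨ *-congʳ yZ≈1 ⟨
      y * Z * (ν c′ * ν (suc N) * ν 2 * (F * (F * F ^ N)))
        ≈⟨ solve 7 (λ y z c n d f p → y :* z :* (c :* n :* d :* (f :* (f :* p)))
                      := y :* (c :* (n :* (p :* (d :* z :* (f :* f))))))
             refl y Z (ν c′) (ν (suc N)) (ν 2) F (F ^ N) ⟩
      y * (ν c′ * (ν (suc N) * (F ^ N * (ν 2 * Z * (F * F)))))
        ≈⟨ *-congˡ (*-congˡ (*-congˡ (*-congˡ ∂F≈2ZF²))) ⟨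
      y * (ν c′ * (ν (suc N) * (F ^ N * ∂ F)))
        ≈⟨ *-congˡ (*-congˡ (∂-^ F N)) ⟨
      y * (ν c′ * ∂ (F ^ suc N))
        ≈⟨ *-congˡ (∂-scale (∂-ν c′) (F ^ suc N)) ⟨
      y * ∂ (ν c′ * F ^ suc N)
        ≈⟨ *-congˡ (∂-cong (power-expansion N)) ⟩
      y * ∂ (∑[ i < suc N ] (summand N i))
        ≈⟨ *-congˡ (∂-∑< (suc N) (summand N)) ⟩
      y * (∑[ i < suc N ] (∂ (summand N i)))
        ≈⟨ *-distribˡ-∑< (suc N) y (λ i → ∂ (summand N i)) ⟩
      (∑[ i < suc N ] (y * ∂ (summand N i)))
        ≈⟨ ∑<-cong (suc N) (λ i _ → y∂-summand N i) ⟩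
      (∑[ i < suc N ] (P N i + Q N i))
        ≈⟨ ∑<-distrib-+ (suc N) (P N) (Q N) ⟩
      ∑< (suc N) (P N) + ∑< (suc N) (Q N)
        -- The vanishing term `P N (suc N)` is appended so that, with `P N 0` split off, the
        -- remaining `P N (suc i)` run over the same `i` as the `Q N i` and combine with them into
        -- `summand (suc N) (suc i)`.
        ≈⟨ +-congʳ (+-identityʳ _) ⟨
      ∑< (suc N) (P N) + 0# + ∑< (suc N) (Q N)
        ≈⟨ +-congʳ (+-congˡ (P-outside N (suc N) ℕₚ.≤-refl)) ⟨
      ∑< (suc N) (P N) + P N (suc N) + ∑< (suc N) (Q N)
        ≈⟨ +-congʳ (∑<-last (suc N) (P N)) ⟨
      P N 0 + (∑[ i < suc N ] (P N (suc i))) + ∑< (suc N) (Q N)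
        ≈⟨ +-assoc _ _ _ ⟩
      P N 0 + ((∑[ i < suc N ] (P N (suc i))) + ∑< (suc N) (Q N))
        ≈⟨ +-cong (summand-zero N) (∑<-distrib-+ (suc N) (λ i → P N (suc i)) (Q N)) ⟨
      summand (suc N) 0 + (∑[ i < suc N ] (P N (suc i) + Q N i))
        ≈⟨ +-congˡ (∑<-cong (suc N) (λ i i<1+N → summand-suc N i (ℕₚ.≤-pred i<1+N))) ⟨
      (∑[ i < 2 ℕ.+ N ] (summand (suc N) i)) ∎
      where
      c′ = 2 ℕ.^ N ℕ.* N !
      ν-factor : ν (2 ℕ.^ suc N ℕ.* suc N !) ≈ ν c′ * ν (suc N) * ν 2
      ν-factor = begin
        ν (2 ℕ.* 2 ℕ.^ N ℕ.* (suc N ℕ.* N !))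
          ≡⟨ ≡.cong ν (rearrange (2 ℕ.^ N) (suc N) (N !)) ⟩
        ν (c′ ℕ.* suc N ℕ.* 2)  ≈⟨ ν-* (c′ ℕ.* suc N) 2 ⟩
        ν (c′ ℕ.* suc N) * ν 2  ≈⟨ *-congʳ (ν-* c′ (suc N)) ⟩
        ν c′ * ν (suc N) * ν 2  ∎
        where
        rearrange : ∀ p n f → (2 ℕ.* p) ℕ.* (n ℕ.* f) ≡ p ℕ.* f ℕ.* n ℕ.* 2
        rearrange = ℕ-solve-∀

    -- Leibniz' rule for G = (1+t)F: the second derivative of 1+t is zero, so only two terms
    -- survive.
    ∂^-G : ∀ i → ∂^ (suc i) G ≈ (1# + t) * ∂^ (suc i) F + ν (suc i) * ∂^ i F
    ∂^-G zero = begin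
      ∂ G
        ≈⟨ ∂-cong G≈ ⟩
      ∂ ((1# + t) * F)
        ≈⟨ ∂-* (1# + t) F ⟩
      ∂ (1# + t) * F + (1# + t) * ∂ F
        ≈⟨ +-congʳ (*-congʳ ∂[1+t]) ⟩
      (0# + 1#) * F + (1# + t) * ∂ F
        ≈⟨ solve 2 (λ f d → (con 0 :+ con 1) :* f :+ d := d :+ (con 1 :+ con 0) :* f)
             refl F ((1# + t) * ∂ F) ⟩
      (1# + t) * ∂ F + ν 1 * F ∎
      where
      G≈ : G ≈ (1# + t) * F
      G≈ = sym (trans (solve 3 (λ s u g → s :* (u :* g) := u :* s :* g) refl (1# + t) u G)
                      (trans (*-congʳ u-inverse) (*-identityˡ G)))
      ∂[1+t] : ∂ (1# + t) ≈ 0# + 1#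
      ∂[1+t] = trans (∂-+ 1# t) (+-cong ∂1≈0 ∂t≈1)
    ∂^-G (suc i) = begin
      ∂ (∂^ (suc i) G)
        ≈⟨ ∂-cong (∂^-G i) ⟩
      ∂ ((1# + t) * F₁ + ν (suc i) * ∂^ i F)
        ≈⟨ ∂-+ _ _ ⟩
      ∂ ((1# + t) * F₁) + ∂ (ν (suc i) * ∂^ i F)
        ≈⟨ +-cong (∂-* (1# + t) F₁) (∂-scale (∂-ν (suc i)) (∂^ i F)) ⟩
      ∂ (1# + t) * F₁ + (1# + t) * ∂ F₁ + ν (suc i) * F₁
        ≈⟨ +-congʳ (+-congʳ (*-congʳ (trans (∂-+ 1# t) (+-cong ∂1≈0 ∂t≈1)))) ⟩
      (0# + 1#) * F₁ + (1# + t) * ∂ F₁ + ν (suc i) * F₁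
        ≈⟨ solve 3 (λ f d n → (con 0 :+ con 1) :* f :+ d :+ n :* f := d :+ (con 1 :+ n) :* f)
             refl F₁ ((1# + t) * ∂ F₁) (ν (suc i)) ⟩
      (1# + t) * ∂ F₁ + ν (2 ℕ.+ i) * F₁ ∎
      where F₁ = ∂^ (suc i) F

    -- Solving `∂^-G` for the top derivative gives ∂^(i+1)F = u (∂^(i+1)G - (i+1) ∂ⁱF), which is
    -- iterated. The coefficients (-1)^(i-l) i!/l! enter only through the recursion that determines
    -- them, which keeps quotients of factorials out of the abstract ring.
    ∂^-F : (b : ℕ → ℕ → Carrier) → (∀ i → b i i ≈ 1#) →
           (∀ i l → l ℕ.≤ i → b (suc i) l ≈ - ν (suc i) * b i l) →
           ∀ i → ∂^ i F ≈ ∑[ l < suc i ] (b i l * (u ^ suc (i ∸ l) * ∂^ l G))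
    ∂^-F b b-diag b-step zero = trans
      (solve 2 (λ u g → u :* g := con 1 :* (u :* con 1 :* g) :+ con 0) refl u G)
      (+-congʳ (*-congʳ (sym (b-diag 0))))
    ∂^-F b b-diag b-step (suc i) = begin
      F₁
        ≈⟨ +-cancelʳ (u * (ν (suc i) * ∂^ i F)) _ _ difference ⟩
      u * (- ν (suc i) * ∂^ i F) + u * ∂^ (suc i) G
        ≈⟨ +-congʳ (*-congˡ (*-congˡ (∂^-F b b-diag b-step i))) ⟩
      u * (- ν (suc i) * (∑[ l < suc i ] (b i l * (u ^ suc (i ∸ l) * ∂^ l G)))) + u * ∂^ (suc i) G
        ≈⟨ +-cong lower top ⟩
      (∑[ l < suc i ] (b (suc i) l * (u ^ suc (suc i ∸ l) * ∂^ l G)))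
        + b (suc i) (suc i) * (u ^ suc (suc i ∸ suc i) * ∂^ (suc i) G)
        ≈⟨ ∑<-last (suc i) (λ l → b (suc i) l * (u ^ suc (suc i ∸ l) * ∂^ l G)) ⟨
      (∑[ l < 2 ℕ.+ i ] (b (suc i) l * (u ^ suc (suc i ∸ l) * ∂^ l G))) ∎
      where
      F₁ = ∂^ (suc i) F
      difference : F₁ + u * (ν (suc i) * ∂^ i F)
                 ≈ u * (- ν (suc i) * ∂^ i F) + u * ∂^ (suc i) G + u * (ν (suc i) * ∂^ i F)
      difference = begin
        F₁ + u * (ν (suc i) * ∂^ i F)
          ≈⟨ +-congʳ (trans (*-congʳ u-inverse) (*-identityˡ F₁)) ⟨
        u * (1# + t) * F₁ + u * (ν (suc i) * ∂^ i F)
          ≈⟨ solve 4 (λ u s f m → u :* s :* f :+ u :* m := u :* (s :* f :+ m))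
               refl u (1# + t) F₁ (ν (suc i) * ∂^ i F) ⟩
        u * ((1# + t) * F₁ + ν (suc i) * ∂^ i F)
          ≈⟨ *-congˡ (∂^-G i) ⟨
        u * ∂^ (suc i) G
          ≈⟨ solve 3 (λ u g f → u :* g := u :* (con 0 :* f) :+ u :* g) refl u (∂^ (suc i) G) (∂^ i F) ⟩
        u * (0# * ∂^ i F) + u * ∂^ (suc i) G
          ≈⟨ +-congʳ (*-congˡ (*-congʳ (-‿inverseˡ (ν (suc i))))) ⟨
        u * ((- ν (suc i) + ν (suc i)) * ∂^ i F) + u * ∂^ (suc i) G
          ≈⟨ solve 5 (λ u m n f g → u :* ((m :+ n) :* f) :+ u :* g
                        := u :* (m :* f) :+ u :* g :+ u :* (n :* f))
               refl u (- ν (suc i)) (ν (suc i)) (∂^ i F) (∂^ (suc i) G) ⟩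
        u * (- ν (suc i) * ∂^ i F) + u * ∂^ (suc i) G + u * (ν (suc i) * ∂^ i F) ∎
      top : u * ∂^ (suc i) G ≈ b (suc i) (suc i) * (u ^ suc (suc i ∸ suc i) * ∂^ (suc i) G)
      top = begin
        u * ∂^ (suc i) G
          ≈⟨ solve 2 (λ u g → u :* g := con 1 :* (u :* con 1 :* g)) refl u (∂^ (suc i) G) ⟩
        1# * (u ^ 1 * ∂^ (suc i) G)
          ≈⟨ *-cong (b-diag (suc i)) (*-congʳ (reflexive (≡.cong (λ m → u ^ suc m) (ℕₚ.n∸n≡0 i)))) ⟨
        b (suc i) (suc i) * (u ^ suc (suc i ∸ suc i) * ∂^ (suc i) G) ∎
      lower : u * (- ν (suc i) * (∑[ l < suc i ] (b i l * (u ^ suc (i ∸ l) * ∂^ l G))))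
            ≈ (∑[ l < suc i ] (b (suc i) l * (u ^ suc (suc i ∸ l) * ∂^ l G)))
      lower = begin
        u * (- ν (suc i) * (∑[ l < suc i ] (b i l * (u ^ suc (i ∸ l) * ∂^ l G))))
          ≈⟨ *-assoc _ _ _ ⟨
        u * - ν (suc i) * (∑[ l < suc i ] (b i l * (u ^ suc (i ∸ l) * ∂^ l G)))
          ≈⟨ *-distribˡ-∑< (suc i) (u * - ν (suc i)) (λ l → b i l * (u ^ suc (i ∸ l) * ∂^ l G)) ⟩
        (∑[ l < suc i ] (u * - ν (suc i) * (b i l * (u ^ suc (i ∸ l) * ∂^ l G))))
          ≈⟨ ∑<-cong (suc i) (λ l l<1+i → begin
               u * - ν (suc i) * (b i l * (u ^ suc (i ∸ l) * ∂^ l G))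
                 ≈⟨ solve 5 (λ u n b p g → u :* n :* (b :* (p :* g)) := n :* b :* (u :* p :* g))
                      refl u (- ν (suc i)) (b i l) (u ^ suc (i ∸ l)) (∂^ l G) ⟩
               - ν (suc i) * b i l * (u ^ (2 ℕ.+ (i ∸ l)) * ∂^ l G)
                 ≈⟨ *-cong (b-step i l (ℕₚ.≤-pred l<1+i)) (*-congʳ (reflexive
                      (≡.cong (λ m → u ^ suc m) (ℕₚ.+-∸-assoc 1 (ℕₚ.≤-pred l<1+i))))) ⟨
               b (suc i) l * (u ^ suc (suc i ∸ l) * ∂^ l G) ∎) ⟩
        (∑[ l < suc i ] (b (suc i) l * (u ^ suc (suc i ∸ l) * ∂^ l G))) ∎

-- Ranges of summation and rational arithmetic

module _ where
  open ≡ using (refl; sym; trans; cong; cong₂)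
  open ≡.≡-Reasoning

  <∸⇒+< : ∀ a {k n} → k ℕ.< n ∸ a → a ℕ.+ k ℕ.< n
  <∸⇒+< zero            k<n   = k<n
  <∸⇒+< (suc a) {n = suc n} k<n∸a = s≤s (<∸⇒+< a k<n∸a)

  module BigOp {c ℓ} (M : CommutativeMonoid c ℓ) where
    open CommutativeMonoid M using (_≈_; _∙_; ∙-cong; rawMonoid; reflexive) renaming (trans to ≈-trans)
    open RangeSum M

    bigOp-cong : ∀ a b {f g} → (∀ k → k ℕ.≤ b → f k ≈ g k) →
                 bigOp rawMonoid a b f ≈ bigOp rawMonoid a b g
    bigOp-cong a b f≈g = ∑<-cong (suc b ∸ a) λ k k<1+b∸a →
      f≈g (a ℕ.+ k) (ℕₚ.≤-pred (<∸⇒+< a k<1+b∸a))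

    bigOp-last : ∀ a b f → a ℕ.≤ suc b →
                 bigOp rawMonoid a (suc b) f ≈ bigOp rawMonoid a b f ∙ f (suc b)
    bigOp-last a b f a≤1+b = ≈-trans
      (reflexive (cong (λ n → ∑[ k < n ] (f (a ℕ.+ k))) (ℕₚ.+-∸-assoc 1 a≤1+b)))
      (≈-trans (∑<-last (suc b ∸ a) (λ k → f (a ℕ.+ k)))
               (∙-cong (reflexive refl) (reflexive (cong f (ℕₚ.m+[n∸m]≡n a≤1+b)))))

  private
    module Σℕ = BigOp ℕₚ.+-0-commutativeMonoid
    module Σℚ = RingSum ℚₚ.+-*-commutativeRing
    module Πℚ = BigOp ℚₚ.*-1-commutativeMonoid

  -- Normalised fractions carry a reduction by the gcd. Through the unnormalised ones the identities
  -- below become cross-multiplications of integers.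
  fromℚᵘ-homo-+ : ∀ p q → ℚ.fromℚᵘ (p ℚᵘ.+ q) ≡ ℚ.fromℚᵘ p ℚ.+ ℚ.fromℚᵘ q
  fromℚᵘ-homo-+ p q = ℚₚ.toℚᵘ-injective (ℚᵘₚ.≃-trans (ℚₚ.toℚᵘ-fromℚᵘ (p ℚᵘ.+ q)) (ℚᵘₚ.≃-sym
    (ℚᵘₚ.≃-trans (ℚₚ.toℚᵘ-homo-+ (ℚ.fromℚᵘ p) (ℚ.fromℚᵘ q))
                 (ℚᵘₚ.+-cong (ℚₚ.toℚᵘ-fromℚᵘ p) (ℚₚ.toℚᵘ-fromℚᵘ q)))))

  fromℚᵘ-homo-* : ∀ p q → ℚ.fromℚᵘ (p ℚᵘ.* q) ≡ ℚ.fromℚᵘ p ℚ.* ℚ.fromℚᵘ q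
  fromℚᵘ-homo-* p q = ℚₚ.toℚᵘ-injective (ℚᵘₚ.≃-trans (ℚₚ.toℚᵘ-fromℚᵘ (p ℚᵘ.* q)) (ℚᵘₚ.≃-sym
    (ℚᵘₚ.≃-trans (ℚₚ.toℚᵘ-homo-* (ℚ.fromℚᵘ p) (ℚ.fromℚᵘ q))
                 (ℚᵘₚ.*-cong (ℚₚ.toℚᵘ-fromℚᵘ p) (ℚₚ.toℚᵘ-fromℚᵘ q)))))

  fromℕ-+ : ∀ m n → fromℕ (m ℕ.+ n) ≡ fromℕ m ℚ.+ fromℕ n
  fromℕ-+ m n = trans
    (ℚₚ.fromℚᵘ-cong {mkℚᵘ (+ (m ℕ.+ n)) 0} {mkℚᵘ (+ m) 0 ℚᵘ.+ mkℚᵘ (+ n) 0}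
      (*≡* (cong (ℤ._* + 1) (sym (cong₂ ℤ._+_ (ℤₚ.*-identityʳ (+ m)) (ℤₚ.*-identityʳ (+ n)))))))
    (fromℚᵘ-homo-+ (mkℚᵘ (+ m) 0) (mkℚᵘ (+ n) 0))

  fromℕ-* : ∀ m n → fromℕ (m ℕ.* n) ≡ fromℕ m ℚ.* fromℕ n
  fromℕ-* m n = trans
    (ℚₚ.fromℚᵘ-cong {mkℚᵘ (+ (m ℕ.* n)) 0} {mkℚᵘ (+ m) 0 ℚᵘ.* mkℚᵘ (+ n) 0}
      (*≡* (cong (ℤ._* + 1) (ℤₚ.pos-* m n))))
    (fromℚᵘ-homo-* (mkℚᵘ (+ m) 0) (mkℚᵘ (+ n) 0))

  /-*-cancel : ∀ m d .{{_ : ℕ.NonZero d}} → (+ m ℚ./ d) ℚ.* fromℕ d ≡ fromℕ m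
  /-*-cancel m (suc d) = trans (sym (fromℚᵘ-homo-* (mkℚᵘ (+ m) d) (mkℚᵘ (+ suc d) 0)))
    (ℚₚ.fromℚᵘ-cong {mkℚᵘ (+ m) d ℚᵘ.* mkℚᵘ (+ suc d) 0} {mkℚᵘ (+ m) 0}
      (*≡* (trans (ℤₚ.*-identityʳ (+ m ℤ.* + suc d))
                  (cong (λ e → + m ℤ.* + e) (sym (ℕₚ.*-identityʳ (suc d)))))))

  /-split : ∀ m d .{{_ : ℕ.NonZero d}} → + m ℚ./ d ≡ fromℕ m ℚ.* (+ 1 ℚ./ d)
  /-split m (suc d) = trans
    (ℚₚ.fromℚᵘ-cong {mkℚᵘ (+ m) d} {mkℚᵘ (+ m) 0 ℚᵘ.* mkℚᵘ (+ 1) d}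
      (*≡* (cong₂ (λ n e → n ℤ.* + e) (sym (ℤₚ.*-identityʳ (+ m))) (ℕₚ.+-identityʳ (suc d)))))
    (fromℚᵘ-homo-* (mkℚᵘ (+ m) 0) (mkℚᵘ (+ 1) d))

  -- The definition splits off the last factor, whereas the recursion in N consumes the first one.
  fallingFactorial-front : ∀ y n → fallingFactorial y (suc n) ≡ y ℚ.* fallingFactorial (y ℚ.- 1ℚ) n
  fallingFactorial-front y zero =
    trans (ℚₚ.*-identityˡ _) (trans (ℚₚ.+-identityʳ y) (sym (ℚₚ.*-identityʳ y)))
  fallingFactorial-front y (suc n) = begin
    fallingFactorial y (suc n) ℚ.* (y ℚ.- fromℕ (suc n))
      ≡⟨ cong₂ (λ p q → p ℚ.* (y ℚ.- q)) (fallingFactorial-front y n) (fromℕ-+ 1 n) ⟩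
    y ℚ.* fallingFactorial (y ℚ.- 1ℚ) n ℚ.* (y ℚ.- (1ℚ ℚ.+ fromℕ n))
      ≡⟨ solve 4 (λ y f o n → y :* f :* (y :- (o :+ n)) := y :* (f :* (y :- o :- n))) refl
           y (fallingFactorial (y ℚ.- 1ℚ) n) 1ℚ (fromℕ n) ⟩
    y ℚ.* (fallingFactorial (y ℚ.- 1ℚ) n ℚ.* (y ℚ.- 1ℚ ℚ.- fromℕ n)) ∎
    where open +-*-Solver

  nested∑-cong : ∀ r M {g h} → (∀ k → g k ≡ h k) → nested∑ r M g ≡ nested∑ r M h
  nested∑-cong zero    M g≡h = g≡h _
  nested∑-cong (suc r) M g≡h = Σℚ.∑<-cong (suc M) λ v _ →
    nested∑-cong r (M ∸ v) λ k → g≡h (k [ suc r ≔ v ])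

  nested∑-scale : ∀ r M c g → nested∑ r M (λ k → c ℚ.* g k) ≡ c ℚ.* nested∑ r M g
  nested∑-scale zero    M c g = refl
  nested∑-scale (suc r) M c g = trans
    (Σℚ.∑<-cong (suc M) λ v _ → nested∑-scale r (M ∸ v) c λ k → g (k [ suc r ≔ v ]))
    (sym (Σℚ.*-distribˡ-∑< (suc M) c λ v → nested∑ r (M ∸ v) λ k → g (k [ suc r ≔ v ])))

  ≔-same : ∀ k r v → (k [ r ≔ v ]) r ≡ v
  ≔-same k r v with r ≡ᵇ r | ≡ᵇ-refl r
    where
    ≡ᵇ-refl : ∀ r → (r ≡ᵇ r) ≡ true
    ≡ᵇ-refl zero    = refl
    ≡ᵇ-refl (suc r) = ≡ᵇ-refl r
  ... | true | refl = refl

  ≔-below : ∀ k {r l} v → l ℕ.< r → (k [ r ≔ v ]) l ≡ k l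
  ≔-below k {r} {l} v l<r with l ≡ᵇ r | <⇒≢ᵇ l<r
    where
    <⇒≢ᵇ : ∀ {l r} → l ℕ.< r → (l ≡ᵇ r) ≡ false
    <⇒≢ᵇ {zero}  {suc r} _         = refl
    <⇒≢ᵇ {suc l} {suc r} (s≤s l<r) = <⇒≢ᵇ l<r
  ... | false | refl = refl

  ∑-≔ : ∀ a i k v → a ℕ.≤ suc i →
        (∑ℕ[ l ∈ a ⋯ suc i ] (k [ suc i ≔ v ]) l) ≡ (∑ℕ[ l ∈ a ⋯ i ] k l) ℕ.+ v
  ∑-≔ a i k v a≤1+i = trans (Σℕ.bigOp-last a i (k [ suc i ≔ v ]) a≤1+i)
    (cong₂ ℕ._+_ (Σℕ.bigOp-cong a i λ l l≤i → ≔-below k v (s≤s l≤i)) (≔-same k (suc i) v))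

  -- The numbers a_i(N)

  aFactor : (i N : ℕ) → (ℕ → ℕ) → ℕ → ℚ
  aFactor i N k j =
    fallingFactorial
      (fromℕ N ℚ.- fromℕ (∑ℕ[ l ∈ j ⋯ i ∸ 1 ] k l) ℚ.- (+ (2 ℕ.* i ℕ.+ 2 ∸ j) ℚ./ 2))
      (k (j ∸ 1))

  aSummand : (i N : ℕ) → (ℕ → ℕ) → ℚ
  aSummand i N k =
    fromℕ (2 ℕ.^ (∑ℕ[ j ∈ 1 ⋯ i ∸ 1 ] k j))
    ℚ.* (∏ℚ[ j ∈ 2 ⋯ i ] aFactor i N k j)
    ℚ.* fromℕ ⟨2 N ∸ i ∸ (∑ℕ[ j ∈ 1 ⋯ i ∸ 1 ] k j) -1⟩!!

  -- 2^v (N-i/2-2)_v = ∏_{r<v} (2(N-1-r)-(i+2)), the factor that the recursion for A collects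
  -- on the way from A (i+2) N down to A (i+1) (N-1-v).
  weight : (i N v : ℕ) → ℚ
  weight i N v = fromℕ (2 ℕ.^ v) ℚ.* fallingFactorial (fromℕ N ℚ.- (+ (4 ℕ.+ i) ℚ./ 2)) v

  module _ (i N v : ℕ) (k : ℕ → ℕ) (v<N : v ℕ.< N) where
    private
      k′ : ℕ → ℕ
      k′ = k [ suc i ≔ v ]
      N≡ : N ≡ (N ∸ 1 ∸ v) ℕ.+ suc v
      N≡ = sym (trans (cong (ℕ._+ suc v) (ℕₚ.∸-+-assoc N 1 v)) (ℕₚ.m∸n+n≡m v<N))

    -- Fixing the outermost index at `v` adds `v` to every inner sum, and `2 + i` in place of
    -- `1 + i` adds 1 to the half-integer. Both are absorbed when N is replaced by N-1-v.
    aFactor-below : ∀ j → j ℕ.≤ suc i → aFactor (2 ℕ.+ i) N k′ j ≡ aFactor (1 ℕ.+ i) (N ∸ 1 ∸ v) k j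
    aFactor-below j j≤1+i = cong₂ fallingFactorial argument (≔-below k v (j∸1< j j≤1+i))
      where
      open +-*-Solver
      j∸1< : ∀ j → j ℕ.≤ suc i → j ∸ 1 ℕ.< suc i
      j∸1< zero    _   = s≤s z≤n
      j∸1< (suc j) j<i = j<i
      N′ = N ∸ 1 ∸ v
      S  = ∑ℕ[ l ∈ j ⋯ i ] k l
      e  = 2 ℕ.* suc i ℕ.+ 2 ∸ j
      2+e≡ : 2 ℕ.* (2 ℕ.+ i) ℕ.+ 2 ∸ j ≡ 2 ℕ.+ e
      2+e≡ = trans (cong (λ n → n ℕ.+ 2 ∸ j) (ℕₚ.*-suc 2 (suc i)))
        (ℕₚ.+-∸-assoc 2 (ℕₚ.≤-trans j≤1+i (ℕₚ.≤-trans (ℕₚ.m≤n*m (suc i) 2) (ℕₚ.m≤m+n _ 2))))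
      fromℕ-N : fromℕ N ≡ fromℕ N′ ℚ.+ (1ℚ ℚ.+ fromℕ v)
      fromℕ-N = trans (cong fromℕ N≡) (trans (fromℕ-+ N′ (suc v)) (cong (fromℕ N′ ℚ.+_) (fromℕ-+ 1 v)))
      argument :
        fromℕ N ℚ.- fromℕ (∑ℕ[ l ∈ j ⋯ suc i ] k′ l) ℚ.- (+ (2 ℕ.* (2 ℕ.+ i) ℕ.+ 2 ∸ j) ℚ./ 2)
        ≡ fromℕ N′ ℚ.- fromℕ S ℚ.- (+ e ℚ./ 2)
      argument = begin
        fromℕ N ℚ.- fromℕ (∑ℕ[ l ∈ j ⋯ suc i ] k′ l) ℚ.- (+ (2 ℕ.* (2 ℕ.+ i) ℕ.+ 2 ∸ j) ℚ./ 2)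
          ≡⟨ cong₂ (λ s e → fromℕ N ℚ.- fromℕ s ℚ.- (+ e ℚ./ 2))
               (∑-≔ j i k v j≤1+i) 2+e≡ ⟩
        fromℕ N ℚ.- fromℕ (S ℕ.+ v) ℚ.- (+ (2 ℕ.+ e) ℚ./ 2)
          ≡⟨ cong₂ ℚ._-_ (cong₂ ℚ._-_ fromℕ-N (fromℕ-+ S v))
               (trans (/-split (2 ℕ.+ e) 2) (trans (cong (ℚ._* (+ 1 ℚ./ 2)) (fromℕ-+ 2 e))
                 (ℚₚ.*-distribʳ-+ (+ 1 ℚ./ 2) (fromℕ 2) (fromℕ e)))) ⟩
        fromℕ N′ ℚ.+ (1ℚ ℚ.+ fromℕ v) ℚ.- (fromℕ S ℚ.+ fromℕ v) ℚ.- (1ℚ ℚ.+ fromℕ e ℚ.* (+ 1 ℚ./ 2))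
          ≡⟨ solve 5 (λ n o v s h → n :+ (o :+ v) :- (s :+ v) :- (o :+ h) := n :- s :- h) refl
               (fromℕ N′) 1ℚ (fromℕ v) (fromℕ S) (fromℕ e ℚ.* (+ 1 ℚ./ 2)) ⟩
        fromℕ N′ ℚ.- fromℕ S ℚ.- fromℕ e ℚ.* (+ 1 ℚ./ 2)
          ≡⟨ cong (λ h → fromℕ N′ ℚ.- fromℕ S ℚ.- h) (/-split e 2) ⟨
        fromℕ N′ ℚ.- fromℕ S ℚ.- (+ e ℚ./ 2) ∎

    aFactor-top : aFactor (2 ℕ.+ i) N k′ (2 ℕ.+ i) ≡ fallingFactorial (fromℕ N ℚ.- (+ (4 ℕ.+ i) ℚ./ 2)) v
    aFactor-top = cong₂ fallingFactorial
      (trans (cong₂ (λ m e → fromℕ N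
                 ℚ.- fromℕ (RangeSum.∑< ℕₚ.+-0-commutativeMonoid m λ l → k′ (2 ℕ.+ i ℕ.+ l))
                 ℚ.- (+ e ℚ./ 2))
               -- The sum from `2 + i` to `1 + i` is empty: its length reduces to `i ∸ i`.
               (ℕₚ.n∸n≡0 i) exponent)
             (cong (ℚ._- (+ (4 ℕ.+ i) ℚ./ 2)) (ℚₚ.+-identityʳ (fromℕ N))))
      (≔-same k (suc i) v)
      where
      rearrange : ∀ i → 2 ℕ.* (2 ℕ.+ i) ℕ.+ 2 ≡ (4 ℕ.+ i) ℕ.+ (2 ℕ.+ i)
      rearrange = ℕ-solve-∀
      exponent : 2 ℕ.* (2 ℕ.+ i) ℕ.+ 2 ∸ (2 ℕ.+ i) ≡ 4 ℕ.+ i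
      exponent = trans (cong (_∸ (2 ℕ.+ i)) (rearrange i)) (ℕₚ.m+n∸n≡m (4 ℕ.+ i) (2 ℕ.+ i))

    -- The power of 2 and the top factor of the product release the weight of `v`. The argument of
    -- the double factorial is unchanged, because N-(i+2)-(S+v) = (N-1-v)-(i+1)-S.
    aSummand-≔ : aSummand (2 ℕ.+ i) N k′ ≡ weight i N v ℚ.* aSummand (1 ℕ.+ i) (N ∸ 1 ∸ v) k
    aSummand-≔ = begin
      aSummand (2 ℕ.+ i) N k′
        ≡⟨ cong₂ (λ s p → fromℕ (2 ℕ.^ s) ℚ.* p ℚ.* fromℕ ⟨2 N ∸ (2 ℕ.+ i) ∸ s -1⟩!!)
             (∑-≔ 1 i k v (s≤s z≤n))
             (trans (Πℚ.bigOp-last 2 (suc i) (aFactor (2 ℕ.+ i) N k′) (s≤s (s≤s z≤n)))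
               (cong₂ ℚ._*_ (Πℚ.bigOp-cong 2 (suc i) aFactor-below) aFactor-top)) ⟩
      fromℕ (2 ℕ.^ (S ℕ.+ v)) ℚ.* (p ℚ.* f) ℚ.* fromℕ ⟨2 N ∸ (2 ℕ.+ i) ∸ (S ℕ.+ v) -1⟩!!
        ≡⟨ cong₂ (λ c n → c ℚ.* (p ℚ.* f) ℚ.* fromℕ ⟨2 n -1⟩!!)
             (trans (cong fromℕ (ℕₚ.^-distribˡ-+-* 2 S v)) (fromℕ-* (2 ℕ.^ S) (2 ℕ.^ v))) remainder ⟩
      fromℕ (2 ℕ.^ S) ℚ.* fromℕ (2 ℕ.^ v) ℚ.* (p ℚ.* f) ℚ.* d
        ≡⟨ solve 5 (λ s t p f d → s :* t :* (p :* f) :* d := t :* f :* (s :* p :* d)) refl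
             (fromℕ (2 ℕ.^ S)) (fromℕ (2 ℕ.^ v)) p f d ⟩
      weight i N v ℚ.* aSummand (1 ℕ.+ i) (N ∸ 1 ∸ v) k ∎
      where
      open +-*-Solver
      S = ∑ℕ[ l ∈ 1 ⋯ i ] k l
      p = ∏ℚ[ j ∈ 2 ⋯ suc i ] aFactor (1 ℕ.+ i) (N ∸ 1 ∸ v) k j
      f = fallingFactorial (fromℕ N ℚ.- (+ (4 ℕ.+ i) ℚ./ 2)) v
      d = fromℕ ⟨2 (N ∸ 1 ∸ v) ∸ suc i ∸ S -1⟩!!
      rearrange : ∀ i S v → 2 ℕ.+ i ℕ.+ (S ℕ.+ v) ≡ 1 ℕ.+ v ℕ.+ (suc i ℕ.+ S)
      rearrange = ℕ-solve-∀
      remainder : N ∸ (2 ℕ.+ i) ∸ (S ℕ.+ v) ≡ N ∸ 1 ∸ v ∸ suc i ∸ S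
      remainder = begin
        N ∸ (2 ℕ.+ i) ∸ (S ℕ.+ v)          ≡⟨ ℕₚ.∸-+-assoc N (2 ℕ.+ i) (S ℕ.+ v) ⟩
        N ∸ (2 ℕ.+ i ℕ.+ (S ℕ.+ v))        ≡⟨ cong (N ∸_) (rearrange i S v) ⟩
        N ∸ (1 ℕ.+ v ℕ.+ (suc i ℕ.+ S))    ≡⟨ ℕₚ.∸-+-assoc N (1 ℕ.+ v) (suc i ℕ.+ S) ⟨
        N ∸ (1 ℕ.+ v) ∸ (suc i ℕ.+ S)      ≡⟨ ℕₚ.∸-+-assoc (N ∸ (1 ℕ.+ v)) (suc i) S ⟨
        N ∸ (1 ℕ.+ v) ∸ suc i ∸ S          ≡⟨ cong (λ n → n ∸ suc i ∸ S) (ℕₚ.∸-+-assoc N 1 v) ⟨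
        N ∸ 1 ∸ v ∸ suc i ∸ S              ∎

  -- Definitionally `a i N` for `i` at least 2. At `i = 1` it is a single summand with no indices,
  -- whose value is again a_1(N), so the induction on `i` can start there.
  aSum : (i N : ℕ) → ℚ
  aSum i N = nested∑ (i ∸ 1) (N ∸ i) (aSummand i N)

  -- With N = 2+i+M the outermost index runs from 0 to `M`, and N-1-v is `1 + i + (M ∸ v)`, so the
  -- inner sum has the same form again.
  aSum-unfold : ∀ i M → aSum (2 ℕ.+ i) (2 ℕ.+ i ℕ.+ M) ≡
    Σℚ.∑< (suc M) λ v → weight i (2 ℕ.+ i ℕ.+ M) v ℚ.* aSum (1 ℕ.+ i) (1 ℕ.+ i ℕ.+ (M ∸ v))
  aSum-unfold i M = begin
    nested∑ (suc i) (N ∸ (2 ℕ.+ i)) (aSummand (2 ℕ.+ i) N)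
      ≡⟨ cong (λ m → nested∑ (suc i) m (aSummand (2 ℕ.+ i) N)) (ℕₚ.m+n∸m≡n (2 ℕ.+ i) M) ⟩
    nested∑ (suc i) M (aSummand (2 ℕ.+ i) N)
      ≡⟨ Σℚ.∑<-cong (suc M) (λ v v<1+M → term v (ℕₚ.≤-pred v<1+M)) ⟩
    (Σℚ.∑< (suc M) λ v → weight i N v ℚ.* aSum (1 ℕ.+ i) (1 ℕ.+ i ℕ.+ (M ∸ v))) ∎
    where
    N = 2 ℕ.+ i ℕ.+ M
    term : ∀ v → v ℕ.≤ M →
      nested∑ i (M ∸ v) (λ k → aSummand (2 ℕ.+ i) N (k [ suc i ≔ v ]))
      ≡ weight i N v ℚ.* aSum (1 ℕ.+ i) (1 ℕ.+ i ℕ.+ (M ∸ v))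
    term v v≤M = begin
      nested∑ i (M ∸ v) (λ k → aSummand (2 ℕ.+ i) N (k [ suc i ≔ v ]))
        ≡⟨ nested∑-cong i (M ∸ v) (λ k →
             aSummand-≔ i N v k (s≤s (ℕₚ.≤-trans v≤M (ℕₚ.m≤n+m M (suc i))))) ⟩
      nested∑ i (M ∸ v) (λ k → weight i N v ℚ.* aSummand (1 ℕ.+ i) (N ∸ 1 ∸ v) k)
        ≡⟨ nested∑-scale i (M ∸ v) (weight i N v) (aSummand (1 ℕ.+ i) (N ∸ 1 ∸ v)) ⟩
      weight i N v ℚ.* nested∑ i (M ∸ v) (aSummand (1 ℕ.+ i) (N ∸ 1 ∸ v))
        ≡⟨ cong₂ (λ n m → weight i N v ℚ.* nested∑ i m (aSummand (1 ℕ.+ i) n))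
             (ℕₚ.+-∸-assoc (1 ℕ.+ i) v≤M) (sym (ℕₚ.m+n∸m≡n (1 ℕ.+ i) (M ∸ v))) ⟩
      weight i N v ℚ.* aSum (1 ℕ.+ i) (1 ℕ.+ i ℕ.+ (M ∸ v)) ∎

  -- Write N for `2 + i + M`. Twice the first factor of the falling factorial is 2(N+1)-(i+4) =
  -- 2N-(i+2), the coefficient in the recursion for `A (2 + i) (suc N)`; the other factors form the
  -- weight at N.
  weight-suc : ∀ i M v → weight i (3 ℕ.+ i ℕ.+ M) (suc v)
    ≡ fromℕ (2 ℕ.* (2 ℕ.+ i ℕ.+ M) ∸ (2 ℕ.+ i)) ℚ.* weight i (2 ℕ.+ i ℕ.+ M) v
  weight-suc i M v = begin
    fromℕ (2 ℕ.* 2 ℕ.^ v) ℚ.* fallingFactorial Y (suc v)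
      ≡⟨ cong₂ ℚ._*_ (fromℕ-* 2 (2 ℕ.^ v)) (fallingFactorial-front Y v) ⟩
    fromℕ 2 ℚ.* fromℕ (2 ℕ.^ v) ℚ.* (Y ℚ.* fallingFactorial (Y ℚ.- 1ℚ) v)
      ≡⟨ solve 4 (λ t p y f → t :* p :* (y :* f) := (t :* y) :* (p :* f)) refl
           (fromℕ 2) (fromℕ (2 ℕ.^ v)) Y (fallingFactorial (Y ℚ.- 1ℚ) v) ⟩
    fromℕ 2 ℚ.* Y ℚ.* (fromℕ (2 ℕ.^ v) ℚ.* fallingFactorial (Y ℚ.- 1ℚ) v)
      ≡⟨ cong₂ (λ c y → c ℚ.* (fromℕ (2 ℕ.^ v) ℚ.* fallingFactorial y v)) 2Y≡ Y-1≡ ⟩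
    fromℕ (2 ℕ.* (2 ℕ.+ i ℕ.+ M) ∸ (2 ℕ.+ i)) ℚ.* weight i (2 ℕ.+ i ℕ.+ M) v ∎
    where
    open +-*-Solver
    N = 2 ℕ.+ i ℕ.+ M
    Y = fromℕ (suc N) ℚ.- (+ (4 ℕ.+ i) ℚ./ 2)
    e = 2 ℕ.* N ∸ (2 ℕ.+ i)
    Y-1≡ : Y ℚ.- 1ℚ ≡ fromℕ N ℚ.- (+ (4 ℕ.+ i) ℚ./ 2)
    Y-1≡ = trans (cong (λ n → n ℚ.- (+ (4 ℕ.+ i) ℚ./ 2) ℚ.- 1ℚ) (fromℕ-+ 1 N))
      (solve 3 (λ o n h → o :+ n :- h :- o := n :- h) refl 1ℚ (fromℕ N) (+ (4 ℕ.+ i) ℚ./ 2))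
    e+[4+i]≡ : e ℕ.+ (4 ℕ.+ i) ≡ 2 ℕ.* suc N
    e+[4+i]≡ = trans (cong (e ℕ.+_) (ℕₚ.+-comm 2 (2 ℕ.+ i))) (trans (sym (ℕₚ.+-assoc e (2 ℕ.+ i) 2))
      (trans (cong (ℕ._+ 2) (ℕₚ.m∸n+n≡m {2 ℕ.* N} {2 ℕ.+ i}
        (ℕₚ.≤-trans (ℕₚ.m≤m+n (2 ℕ.+ i) M) (ℕₚ.m≤n*m N 2))))
        (trans (ℕₚ.+-comm (2 ℕ.* N) 2) (sym (ℕₚ.*-suc 2 N)))))
    2Y≡ : fromℕ 2 ℚ.* Y ≡ fromℕ e
    2Y≡ = begin
      fromℕ 2 ℚ.* (fromℕ (suc N) ℚ.- (+ (4 ℕ.+ i) ℚ./ 2))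
        ≡⟨ solve 3 (λ t n h → t :* (n :- h) := t :* n :- h :* t) refl
             (fromℕ 2) (fromℕ (suc N)) (+ (4 ℕ.+ i) ℚ./ 2) ⟩
      fromℕ 2 ℚ.* fromℕ (suc N) ℚ.- (+ (4 ℕ.+ i) ℚ./ 2) ℚ.* fromℕ 2
        ≡⟨ cong₂ ℚ._-_ (sym (fromℕ-* 2 (suc N))) (/-*-cancel (4 ℕ.+ i) 2) ⟩
      fromℕ (2 ℕ.* suc N) ℚ.- fromℕ (4 ℕ.+ i)
        ≡⟨ cong (ℚ._- fromℕ (4 ℕ.+ i)) (trans (cong fromℕ (sym e+[4+i]≡)) (fromℕ-+ e (4 ℕ.+ i))) ⟩
      fromℕ e ℚ.+ fromℕ (4 ℕ.+ i) ℚ.- fromℕ (4 ℕ.+ i)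
        ≡⟨ solve 2 (λ a b → a :+ b :- b := a) refl (fromℕ e) (fromℕ (4 ℕ.+ i)) ⟩
      fromℕ e ∎

  -- The recursion for `A (2 + i)` unrolled in N: the term `v = 0` is its second summand, and by
  -- `weight-suc` the others are its coefficient times the sum for the preceding `M`. The unrolling
  -- stops at `M = 0`, where the first summand vanishes by `A-outside`.
  A-weighted : ∀ i M → (Σℚ.∑< (suc M) λ v →
      weight i (2 ℕ.+ i ℕ.+ M) v ℚ.* fromℕ (A (1 ℕ.+ i) (1 ℕ.+ i ℕ.+ (M ∸ v))))
    ≡ fromℕ (A (2 ℕ.+ i) (2 ℕ.+ i ℕ.+ M))
  A-weighted i zero = begin
    weight i (2 ℕ.+ i ℕ.+ 0) 0 ℚ.* fromℕ (A (1 ℕ.+ i) N) ℚ.+ 0ℚ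
      ≡⟨ trans (ℚₚ.+-identityʳ _) (ℚₚ.*-identityˡ _) ⟩
    fromℕ (A (1 ℕ.+ i) N)
      ≡⟨ cong fromℕ (sym (cong (ℕ._+ A (1 ℕ.+ i) N) (trans
           (cong ((2 ℕ.* N ∸ (2 ℕ.+ i)) ℕ.*_) (A-outside (2 ℕ.+ i) N
             (s≤s (s≤s (ℕₚ.≤-reflexive (ℕₚ.+-identityʳ i))))))
           (ℕₚ.*-zeroʳ (2 ℕ.* N ∸ (2 ℕ.+ i)))))) ⟩
    fromℕ (A (2 ℕ.+ i) (suc N)) ∎
    where N = 1 ℕ.+ i ℕ.+ 0
  A-weighted i (suc M) = begin
    weight i (2 ℕ.+ i ℕ.+ suc M) 0 ℚ.* fromℕ (A (1 ℕ.+ i) (1 ℕ.+ i ℕ.+ suc M)) ℚ.+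
      (Σℚ.∑< (suc M) λ v →
        weight i (2 ℕ.+ i ℕ.+ suc M) (suc v) ℚ.* fromℕ (A (1 ℕ.+ i) (1 ℕ.+ i ℕ.+ (M ∸ v))))
      ≡⟨ cong₂ ℚ._+_ (ℚₚ.*-identityˡ (fromℕ (A (1 ℕ.+ i) (1 ℕ.+ i ℕ.+ suc M)))) (trans
           (Σℚ.∑<-cong (suc M) λ v _ → trans (cong (ℚ._* b v) (step v)) (ℚₚ.*-assoc (fromℕ e) (w v) (b v)))
           (sym (Σℚ.*-distribˡ-∑< (suc M) (fromℕ e) λ v → w v ℚ.* b v))) ⟩
    fromℕ (A (1 ℕ.+ i) (1 ℕ.+ i ℕ.+ suc M)) ℚ.+ fromℕ e ℚ.* (Σℚ.∑< (suc M) λ v → w v ℚ.* b v)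
      ≡⟨ cong₂ (λ n s → fromℕ (A (1 ℕ.+ i) n) ℚ.+ fromℕ e ℚ.* s) (ℕₚ.+-suc (1 ℕ.+ i) M) (A-weighted i M) ⟩
    fromℕ (A (1 ℕ.+ i) N) ℚ.+ fromℕ e ℚ.* fromℕ (A (2 ℕ.+ i) N)
      ≡⟨ trans (ℚₚ.+-comm (fromℕ (A (1 ℕ.+ i) N)) (fromℕ e ℚ.* fromℕ (A (2 ℕ.+ i) N)))
               (cong (ℚ._+ fromℕ (A (1 ℕ.+ i) N)) (sym (fromℕ-* e (A (2 ℕ.+ i) N)))) ⟩
    fromℕ (e ℕ.* A (2 ℕ.+ i) N) ℚ.+ fromℕ (A (1 ℕ.+ i) N)
      ≡⟨ fromℕ-+ (e ℕ.* A (2 ℕ.+ i) N) (A (1 ℕ.+ i) N) ⟨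
    fromℕ (A (2 ℕ.+ i) (suc N))
      ≡⟨ cong (λ n → fromℕ (A (2 ℕ.+ i) n)) (ℕₚ.+-suc (2 ℕ.+ i) M) ⟨
    fromℕ (A (2 ℕ.+ i) (2 ℕ.+ i ℕ.+ suc M)) ∎
    where
    N = 2 ℕ.+ i ℕ.+ M
    e = 2 ℕ.* N ∸ (2 ℕ.+ i)
    w b : ℕ → ℚ
    w v = weight i N v
    b v = fromℕ (A (1 ℕ.+ i) (1 ℕ.+ i ℕ.+ (M ∸ v)))
    step : ∀ v → weight i (2 ℕ.+ i ℕ.+ suc M) (suc v) ≡ fromℕ e ℚ.* w v
    step v = trans (cong (λ n → weight i n (suc v)) (ℕₚ.+-suc (2 ℕ.+ i) M)) (weight-suc i M v)

  -- The first step of the recursion multiplies by 2 · 0. This is why the outer sum of the theorem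
  -- begins at i = 1.
  A-zero : ∀ N → A 0 (suc N) ≡ 0
  A-zero zero    = refl
  A-zero (suc N) = trans (cong (2 ℕ.* suc N ℕ.*_) (A-zero N)) (ℕₚ.*-zeroʳ (2 ℕ.* suc N))

  A-one : ∀ N → A 1 (suc N) ≡ ⟨2 N -1⟩!!
  A-one zero    = refl
  A-one (suc N) = trans (cong (λ z → (2 ℕ.* suc N ∸ 1) ℕ.* A 1 (suc N) ℕ.+ z) (A-zero N))
    (trans (ℕₚ.+-identityʳ _) (cong₂ ℕ._*_
      (trans (cong (_∸ 1) (ℕₚ.*-suc 2 N)) (ℕₚ.+-comm 1 (2 ℕ.* N))) (A-one N)))

  aSum≡A : ∀ i M → aSum (1 ℕ.+ i) (1 ℕ.+ i ℕ.+ M) ≡ fromℕ (A (1 ℕ.+ i) (1 ℕ.+ i ℕ.+ M))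
  aSum≡A zero    M = trans (ℚₚ.*-identityˡ _) (cong fromℕ (sym (A-one M)))
  aSum≡A (suc i) M = trans (aSum-unfold i M) (trans
    (Σℚ.∑<-cong (suc M) λ v _ → cong (weight i (2 ℕ.+ i ℕ.+ M) v ℚ.*_) (aSum≡A i (M ∸ v)))
    (A-weighted i M))

  a≡A : ∀ i N → 1 ℕ.≤ i → i ℕ.≤ N → a i N ≡ fromℕ (A i N)
  a≡A (suc zero)    (suc N) _ _   = cong fromℕ (sym (A-one N))
  a≡A (suc (suc i)) N       _ i≤N = ≡.subst (λ n → a (2 ℕ.+ i) n ≡ fromℕ (A (2 ℕ.+ i) n))
    (ℕₚ.m+[n∸m]≡n i≤N) (aSum≡A (suc i) (N ∸ (2 ℕ.+ i)))

  -- Quotients of factorials and the coefficients produced by differentiation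

  !/!-diagonal : ∀ i → i !/ i ! ≡ 1ℚ
  !/!-diagonal i = trans (/-split (i !) (i !)) (trans
    (ℚₚ.*-comm (fromℕ (i !)) (+ 1 ℚ./ (i !))) (/-*-cancel 1 (i !)))
    where instance _ = i ℕₚ.!≢0

  !/!-suc : ∀ i l → suc i !/ l ! ≡ fromℕ (suc i) ℚ.* (i !/ l !)
  !/!-suc i l = begin
    + (suc i ℕ.* i !) ℚ./ (l !)
        ≡⟨ /-split (suc i ℕ.* i !) (l !) ⟩
    fromℕ (suc i ℕ.* i !) ℚ.* (+ 1 ℚ./ (l !))
        ≡⟨ cong (ℚ._* (+ 1 ℚ./ (l !))) (fromℕ-* (suc i) (i !)) ⟩
    fromℕ (suc i) ℚ.* fromℕ (i !) ℚ.* (+ 1 ℚ./ (l !))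
        ≡⟨ ℚₚ.*-assoc (fromℕ (suc i)) (fromℕ (i !)) (+ 1 ℚ./ (l !)) ⟩
    fromℕ (suc i) ℚ.* (fromℕ (i !) ℚ.* (+ 1 ℚ./ (l !)))
        ≡⟨ cong (fromℕ (suc i) ℚ.*_) (/-split (i !) (l !)) ⟨
    fromℕ (suc i) ℚ.* (i !/ l !)                        ∎
    where instance _ = l ℕₚ.!≢0

  1/2^*!-cancel : ∀ N → (1/2^ N * N !) ℚ.* fromℕ (2 ℕ.^ N ℕ.* N !) ≡ 1ℚ
  1/2^*!-cancel N = /-*-cancel 1 (2 ℕ.^ N ℕ.* N !)
    where instance
      _ = N ℕₚ.!≢0
      _ = ℕₚ.m^n≢0 2 N
      _ = ℕₚ.m*n≢0 (2 ℕ.^ N) (N !)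

  -- The coefficient of (1+t)^(l-i-1) ∂ˡG in the i-th derivative of (1+t)^(-1) G: the binomial
  -- coefficient of i over l times (-1)^(i-l) (i-l)!.
  leibnizCoefficient : ℕ → ℕ → ℚ
  leibnizCoefficient i l = sgn (i ∸ l) ℚ.* (i !/ l !)

  leibnizCoefficient-diagonal : ∀ i → leibnizCoefficient i i ≡ 1ℚ
  leibnizCoefficient-diagonal i =
    trans (cong₂ (λ n q → sgn n ℚ.* q) (ℕₚ.n∸n≡0 i) (!/!-diagonal i)) (ℚₚ.*-identityˡ 1ℚ)

  leibnizCoefficient-suc : ∀ i l → l ℕ.≤ i →
    leibnizCoefficient (suc i) l ≡ ℚ.- fromℕ (suc i) ℚ.* leibnizCoefficient i l
  leibnizCoefficient-suc i l l≤i = begin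
    sgn (suc i ∸ l) ℚ.* (suc i !/ l !)
      ≡⟨ cong₂ (λ n q → sgn n ℚ.* q) (ℕₚ.+-∸-assoc 1 l≤i) (!/!-suc i l) ⟩
    ℚ.- 1ℚ ℚ.* sgn (i ∸ l) ℚ.* (fromℕ (suc i) ℚ.* (i !/ l !))
      ≡⟨ solve 3 (λ s n q → :- con 1ℚ :* s :* (n :* q) := :- n :* (s :* q)) refl
           (sgn (i ∸ l)) (fromℕ (suc i)) (i !/ l !) ⟩
    ℚ.- fromℕ (suc i) ℚ.* (sgn (i ∸ l) ℚ.* (i !/ l !)) ∎
    where open +-*-Solver

  fallingFactorial-fromℕ : ∀ p l → fallingFactorial (fromℕ (p ℕ.+ suc l)) (suc l)
    ≡ fallingFactorial (fromℕ (suc p ℕ.+ l)) l ℚ.* fromℕ (suc p)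
  fallingFactorial-fromℕ p l = cong₂ ℚ._*_
    (cong (λ n → fallingFactorial (fromℕ n) l) (ℕₚ.+-suc p l))
    (trans (cong (ℚ._- fromℕ l) (trans (cong fromℕ (ℕₚ.+-suc p l)) (fromℕ-+ (suc p) l)))
           (solve 2 (λ a b → a :+ b :- b := a) refl (fromℕ (suc p)) (fromℕ l)))
    where open +-*-Solver

module _ where
  open ≡ using (refl; sym; trans; cong; cong₂)

  -- The rings ℚ[x] and ℚ(x)

  module ℚ[[x]] = FormalSeries ℚₚ.+-*-commutativeRing

  coeff-+ : ∀ p q n → coeff (p +ₚ q) n ≡ coeff p n ℚ.+ coeff q n
  coeff-+ []      q       n       = sym (ℚₚ.+-identityˡ _)
  coeff-+ (c ∷ p) []      n       = sym (ℚₚ.+-identityʳ _)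
  coeff-+ (c ∷ p) (d ∷ q) zero    = refl
  coeff-+ (c ∷ p) (d ∷ q) (suc n) = coeff-+ p q n

  coeff-map : ∀ (f : ℚ → ℚ) → f 0ℚ ≡ 0ℚ → ∀ p n → coeff (map f p) n ≡ f (coeff p n)
  coeff-map f f0≡0 []      n       = sym f0≡0
  coeff-map f f0≡0 (c ∷ p) zero    = refl
  coeff-map f f0≡0 (c ∷ p) (suc n) = coeff-map f f0≡0 p n

  coeff-* : ∀ p q n → coeff (p *ₚ q) n ≡ (coeff p ℚ[[x]].*ₛ coeff q) n
  coeff-* []      q n = sym (ℚ[[x]].S.zeroˡ (coeff q) n)
  coeff-* (c ∷ p) q n = trans (coeff-+ (map (c ℚ.*_) q) (0ℚ ∷ (p *ₚ q)) n)
    (trans (cong (ℚ._+ coeff (0ℚ ∷ (p *ₚ q)) n) (coeff-map (c ℚ.*_) (ℚₚ.*-zeroʳ c) q n)) (tail n))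
    where
    tail : ∀ n → c ℚ.* coeff q n ℚ.+ coeff (0ℚ ∷ (p *ₚ q)) n ≡ (coeff (c ∷ p) ℚ[[x]].*ₛ coeff q) n
    tail zero    = refl
    tail (suc n) = cong (c ℚ.* coeff q (suc n) ℚ.+_) (coeff-* p q n)

  -- Equality of polynomials is equality of all coefficients, so `coeff` is injective by definition
  -- into the power series over ℚ, and the ring laws are pulled back along it.
  polyRing : CommutativeRing 0ℓ 0ℓ
  polyRing = record
    { RawRing polyRawRing
    ; isCommutativeRing = RingMonomorphism.isCommutativeRing isRingMonomorphism
        (CommutativeRing.isCommutativeRing ℚ[[x]].seriesRing)
    }
    where
    open RingMorphisms polyRawRing (CommutativeRing.rawRing ℚ[[x]].seriesRing)
    isRingMonomorphism : IsRingMonomorphism coeff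
    isRingMonomorphism = record
      { isRingHomomorphism = record
        { isSemiringHomomorphism = record
          { isNearSemiringHomomorphism = record
            { +-isMonoidHomomorphism = record
              { isMagmaHomomorphism = record
                { isRelHomomorphism = record { cong = id }
                ; homo = coeff-+
                }
              ; ε-homo = λ _ → refl
              }
            ; *-homo = coeff-*
            }
          ; 1#-homo = λ { zero → refl ; (suc n) → refl }
          }
        ; -‿homo = coeff-map (ℚ.-_) refl
        }
      ; injective = id
      }

  -- The laws of a ring of fractions after cross-multiplication, over an abstract ring so that the
  -- solver meets variables instead of coefficient lists.
  module FractionIdentities {c ℓ} (R : CommutativeRing c ℓ) where
    open CommutativeRing R
      renaming (refl to ≈-refl; sym to ≈-sym; trans to ≈-trans)
    open SetoidReasoning setoid
    open import Algebra.Properties.Ring ring using (-‿distribˡ-*)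
    open import Algebra.Solver.Ring.NaturalCoefficients.Default commutativeSemiring

    -- Cross-multiplication yields transitivity only up to the middle denominator `d`. Removing it
    -- is where the absence of zero divisors in ℚ[x] enters.
    frac-trans : ∀ a b c d e f → a * d ≈ c * b → c * f ≈ e * d → d * (a * f) ≈ d * (e * b)
    frac-trans a b c d e f ad≈cb cf≈ed = begin
      d * (a * f)  ≈⟨ solve 3 (λ d a f → d :* (a :* f) := a :* d :* f) ≈-refl d a f ⟩
      a * d * f    ≈⟨ *-congʳ ad≈cb ⟩
      c * b * f    ≈⟨ solve 3 (λ c b f → c :* b :* f := c :* f :* b) ≈-refl c b f ⟩
      c * f * b    ≈⟨ *-congʳ cf≈ed ⟩
      e * d * b    ≈⟨ solve 3 (λ e d b → e :* d :* b := d :* (e :* b)) ≈-refl e d b ⟩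
      d * (e * b)  ∎

    frac-+-cong : ∀ a b a′ b′ c d c′ d′ → a * b′ ≈ a′ * b → c * d′ ≈ c′ * d →
                  (a * d + c * b) * (b′ * d′) ≈ (a′ * d′ + c′ * b′) * (b * d)
    frac-+-cong a b a′ b′ c d c′ d′ ab′≈a′b cd′≈c′d = begin
      (a * d + c * b) * (b′ * d′)
        ≈⟨ solve 6 (λ a b b′ c d d′ → (a :* d :+ c :* b) :* (b′ :* d′)
                      := a :* b′ :* (d :* d′) :+ c :* d′ :* (b :* b′)) ≈-refl a b b′ c d d′ ⟩
      a * b′ * (d * d′) + c * d′ * (b * b′)
        ≈⟨ +-cong (*-congʳ ab′≈a′b) (*-congʳ cd′≈c′d) ⟩
      a′ * b * (d * d′) + c′ * d * (b * b′)
        ≈⟨ solve 6 (λ a′ b b′ c′ d d′ → a′ :* b :* (d :* d′) :+ c′ :* d :* (b :* b′)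
                      := (a′ :* d′ :+ c′ :* b′) :* (b :* d)) ≈-refl a′ b b′ c′ d d′ ⟩
      (a′ * d′ + c′ * b′) * (b * d) ∎

    frac-*-cong : ∀ a b a′ b′ c d c′ d′ → a * b′ ≈ a′ * b → c * d′ ≈ c′ * d →
                  a * c * (b′ * d′) ≈ a′ * c′ * (b * d)
    frac-*-cong a b a′ b′ c d c′ d′ ab′≈a′b cd′≈c′d = begin
      a * c * (b′ * d′)    ≈⟨ interchange a c b′ d′ ⟩
      a * b′ * (c * d′)    ≈⟨ *-cong ab′≈a′b cd′≈c′d ⟩
      a′ * b * (c′ * d)    ≈⟨ interchange a′ b c′ d ⟩
      a′ * c′ * (b * d)    ∎
      where
      interchange : ∀ a b c d → a * b * (c * d) ≈ a * c * (b * d)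
      interchange = solve 4 (λ a b c d → a :* b :* (c :* d) := a :* c :* (b :* d)) ≈-refl

    frac-neg-cong : ∀ a b a′ b′ → a * b′ ≈ a′ * b → - a * b′ ≈ - a′ * b
    frac-neg-cong a b a′ b′ ab′≈a′b =
      ≈-trans (≈-sym (-‿distribˡ-* a b′)) (≈-trans (-‿cong ab′≈a′b) (-‿distribˡ-* a′ b))

    frac-+-assoc : ∀ a b c d e f →
      ((a * d + c * b) * f + e * (b * d)) * (b * (d * f)) ≈
      (a * (d * f) + (c * f + e * d) * b) * (b * d * f)
    frac-+-assoc = solve 6 (λ a b c d e f →
      ((a :* d :+ c :* b) :* f :+ e :* (b :* d)) :* (b :* (d :* f)) :=
      (a :* (d :* f) :+ (c :* f :+ e :* d) :* b) :* (b :* d :* f)) ≈-refl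

    frac-+-comm : ∀ a b c d → (a * d + c * b) * (d * b) ≈ (c * b + a * d) * (b * d)
    frac-+-comm = solve 4 (λ a b c d →
      (a :* d :+ c :* b) :* (d :* b) := (c :* b :+ a :* d) :* (b :* d)) ≈-refl

    frac-+-identityˡ : ∀ a b → (0# * b + a * 1#) * b ≈ a * (1# * b)
    frac-+-identityˡ = solve 2 (λ a b →
      (con 0 :* b :+ a :* con 1) :* b := a :* (con 1 :* b)) ≈-refl

    frac-inverseˡ : ∀ a b → (- a * b + a * b) * 1# ≈ 0# * (b * b)
    frac-inverseˡ a b = begin
      (- a * b + a * b) * 1#  ≈⟨ *-congʳ (≈-trans (≈-sym (distribʳ b (- a) a)) (*-congʳ (-‿inverseˡ a))) ⟩
      0# * b * 1#             ≈⟨ solve 1 (λ b → con 0 :* b :* con 1 := con 0 :* (b :* b)) ≈-refl b ⟩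
      0# * (b * b)            ∎

    frac-*-assoc : ∀ a b c d e f → a * c * e * (b * (d * f)) ≈ a * (c * e) * (b * d * f)
    frac-*-assoc = solve 6 (λ a b c d e f →
      a :* c :* e :* (b :* (d :* f)) := a :* (c :* e) :* (b :* d :* f)) ≈-refl

    frac-*-comm : ∀ a b c d → a * c * (d * b) ≈ c * a * (b * d)
    frac-*-comm = solve 4 (λ a b c d → a :* c :* (d :* b) := c :* a :* (b :* d)) ≈-refl

    frac-*-identityˡ : ∀ a b → 1# * a * b ≈ a * (1# * b)
    frac-*-identityˡ = solve 2 (λ a b → con 1 :* a :* b := a :* (con 1 :* b)) ≈-refl

    frac-distribʳ : ∀ a b c d e f → (a * d + c * b) * e * (b * f * (d * f)) ≈
                    (a * e * (d * f) + c * e * (b * f)) * (b * d * f)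
    frac-distribʳ = solve 6 (λ a b c d e f →
      (a :* d :+ c :* b) :* e :* (b :* f :* (d :* f)) :=
      (a :* e :* (d :* f) :+ c :* e :* (b :* f)) :* (b :* d :* f)) ≈-refl

    fromRing-+ : ∀ a b → (a + b) * (1# * 1#) ≈ (a * 1# + b * 1#) * 1#
    fromRing-+ = solve 2 (λ a b →
      (a :+ b) :* (con 1 :* con 1) := (a :* con 1 :+ b :* con 1) :* con 1) ≈-refl

    fromRing-* : ∀ a b → a * b * (1# * 1#) ≈ a * b * 1#
    fromRing-* = solve 2 (λ a b → a :* b :* (con 1 :* con 1) := a :* b :* con 1) ≈-refl

    x*1/x : ∀ x → x * 1# * 1# ≈ 1# * (1# * x)
    x*1/x = solve 1 (λ x → x :* con 1 :* con 1 := con 1 :* (con 1 :* x)) ≈-refl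

    cancel-nonZero : (∀ p q → p * q ≈ 0# → ¬ p ≈ 0# → q ≈ 0#) →
                     ∀ d p q → ¬ d ≈ 0# → d * p ≈ d * q → p ≈ q
    cancel-nonZero integral d p q d≉0 dp≈dq = x-y≈0⇒x≈y (integral d (p - q) (begin
      d * (p - q)          ≈⟨ distribˡ d p (- q) ⟩
      d * p + d * (- q)    ≈⟨ +-congʳ dp≈dq ⟩
      d * q + d * (- q)    ≈⟨ distribˡ d q (- q) ⟨
      d * (q - q)          ≈⟨ ≈-trans (*-congˡ (-‿inverseʳ q)) (zeroʳ d) ⟩
      0#                   ∎) d≉0)
      where
      x-y≈0⇒x≈y : p - q ≈ 0# → p ≈ q
      x-y≈0⇒x≈y p-q≈0 = begin
        p              ≈⟨ +-identityʳ p ⟨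
        p + 0#         ≈⟨ +-congˡ (-‿inverseˡ q) ⟨
        p + (- q + q)  ≈⟨ +-assoc p (- q) q ⟨
        p - q + q      ≈⟨ +-congʳ p-q≈0 ⟩
        0# + q         ≈⟨ +-identityˡ q ⟩
        q              ∎

  module P = CommutativeRing polyRing
  open FractionIdentities polyRing

  *ₚ-cancelˡ : ∀ d p q → ¬ d ≈ₚ [] → d *ₚ p ≈ₚ d *ₚ q → p ≈ₚ q
  *ₚ-cancelˡ = cancel-nonZero λ p q pq≈0 p≉0 →
    [ (λ p≈0 → contradiction p≈0 p≉0) , id ]′ (*ₚ-noZeroDivisors p q pq≈0)

  private
    module F = RawRing ratFunRawRing

  ratFun-isCommutativeRing : IsCommutativeRing _≃_ F._+_ F._*_ F.-_ F.0# F.1#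
  ratFun-isCommutativeRing = record
    { isRing = record
      { +-isAbelianGroup = record
        { isGroup = record
          { isMonoid = record
            { isSemigroup = record
              { isMagma = record
                { isEquivalence = record
                  { refl  = λ {f} → P.refl {num f *ₚ den f}
                  ; sym   = λ {f} {g} → P.sym {num f *ₚ den g} {num g *ₚ den f}
                  ; trans = λ {f} {g} {h} → ≃-trans f g h
                  }
                ; ∙-cong = λ {f} {f′} {g} {g′} → frac-+-cong
                    (num f) (den f) (num f′) (den f′) (num g) (den g) (num g′) (den g′)
                }
              ; assoc = λ f g h → frac-+-assoc (num f) (den f) (num g) (den g) (num h) (den h)
              }
            ; identity = +-identityˡ , λ f →
                ≃-trans (f F.+ F.0#) (F.0# F.+ f) f (+-comm f F.0#) (+-identityˡ f)
            }
          ; inverse = +-inverseˡ , λ f →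
              ≃-trans (f F.+ F.- f) (F.- f F.+ f) F.0# (+-comm f (F.- f)) (+-inverseˡ f)
          ; ⁻¹-cong = λ {f} {g} → frac-neg-cong (num f) (den f) (num g) (den g)
          }
        ; comm = +-comm
        }
      ; *-cong = λ {f} {f′} {g} {g′} → frac-*-cong
          (num f) (den f) (num f′) (den f′) (num g) (den g) (num g′) (den g′)
      ; *-assoc = λ f g h → frac-*-assoc (num f) (den f) (num g) (den g) (num h) (den h)
      ; *-identity = *-identityˡ , λ f →
          ≃-trans (f F.* F.1#) (F.1# F.* f) f (*-comm f F.1#) (*-identityˡ f)
      ; distrib = distribˡ , distribʳ
      }
    ; *-comm = *-comm
    }
    where
    ≃-trans : ∀ f g h → f ≃ g → g ≃ h → f ≃ h
    ≃-trans f g h f≃g g≃h = *ₚ-cancelˡ (den g) (num f *ₚ den h) (num h *ₚ den f) (den≉0 g)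
      (frac-trans (num f) (den f) (num g) (den g) (num h) (den h) f≃g g≃h)
    +-comm : ∀ f g → f F.+ g ≃ g F.+ f
    +-comm f g = frac-+-comm (num f) (den f) (num g) (den g)
    +-identityˡ : ∀ f → F.0# F.+ f ≃ f
    +-identityˡ f = frac-+-identityˡ (num f) (den f)
    +-inverseˡ : ∀ f → F.- f F.+ f ≃ F.0#
    +-inverseˡ f = frac-inverseˡ (num f) (den f)
    *-comm : ∀ f g → f F.* g ≃ g F.* f
    *-comm f g = frac-*-comm (num f) (den f) (num g) (den g)
    *-identityˡ : ∀ f → F.1# F.* f ≃ f
    *-identityˡ f = frac-*-identityˡ (num f) (den f)
    distribʳ : ∀ h f g → (f F.+ g) F.* h ≃ f F.* h F.+ g F.* h
    distribʳ h f g = frac-distribʳ (num f) (den f) (num g) (den g) (num h) (den h)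
    +-cong : ∀ f f′ g g′ → f ≃ f′ → g ≃ g′ → f F.+ g ≃ f′ F.+ g′
    +-cong f f′ g g′ = frac-+-cong
      (num f) (den f) (num f′) (den f′) (num g) (den g) (num g′) (den g′)
    distribˡ : ∀ h f g → h F.* (f F.+ g) ≃ h F.* f F.+ h F.* g
    distribˡ h f g = ≃-trans (h F.* (f F.+ g)) ((f F.+ g) F.* h) (h F.* f F.+ h F.* g)
      (*-comm h (f F.+ g))
      (≃-trans ((f F.+ g) F.* h) (f F.* h F.+ g F.* h) (h F.* f F.+ h F.* g) (distribʳ h f g)
        (+-cong (f F.* h) (h F.* f) (g F.* h) (h F.* g) (*-comm f h) (*-comm g h)))

  ratFunRing : CommutativeRing 0ℓ 0ℓ
  ratFunRing = record { isCommutativeRing = ratFun-isCommutativeRing }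

  open RingMorphisms polyRawRing ratFunRawRing using (IsRingHomomorphism)

  ι-isRingHomomorphism : IsRingHomomorphism ι
  ι-isRingHomomorphism = record
    { isSemiringHomomorphism = record
      { isNearSemiringHomomorphism = record
        { +-isMonoidHomomorphism = record
          { isMagmaHomomorphism = record
            { isRelHomomorphism = record { cong = λ {p} {q} p≈q → P.*-congʳ {constₚ 1ℚ} {p} {q} p≈q }
            ; homo = fromRing-+
            }
          ; ε-homo = λ _ → refl
          }
        ; *-homo = fromRing-*
        }
      ; 1#-homo = λ _ → refl
      }
    ; -‿homo = λ _ _ → refl
    }

  X*1/X : ι X F.* frac (constₚ 1ℚ) X X≉0 ≃ F.1#
  X*1/X = x*1/x X

-- Coefficients of both sides in ℚ(x)[[t]]

constₚ-* : ∀ c d → constₚ (c ℚ.* d) ≈ₚ constₚ c *ₚ constₚ d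
constₚ-* c d zero    = ≡.sym (ℚₚ.+-identityʳ (c ℚ.* d))
constₚ-* c d (suc n) = ≡.refl

constₚ-0 : constₚ 0ℚ ≈ₚ []
constₚ-0 zero    = ≡.refl
constₚ-0 (suc n) = ≡.refl

-- `i + suc e` stands for 2N, which exceeds i; so i-2N-m is always negative and `x^_` takes its
-- second clause.
exponent≡ : ∀ i e m → + i ℤ.- + (i ℕ.+ suc e) ℤ.- + m ≡ -[1+ e ℕ.+ m ]
exponent≡ i e m = ≡.trans (≡.cong (ℤ._- + m) i-[i+1+e]≡) (-[1+e]-m m)
  where
  i-[i+1+e]≡ : + i ℤ.- + (i ℕ.+ suc e) ≡ -[1+ e ]
  i-[i+1+e]≡ = ≡.trans (ℤₚ.m-n≡m⊖n i (i ℕ.+ suc e))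
    (≡.trans (≡.cong (ℤ._⊖ (i ℕ.+ suc e)) (≡.sym (ℕₚ.+-identityʳ i))) (ℤₚ.+-cancelˡ-⊖ i 0 (suc e)))
  -[1+e]-m : ∀ m → -[1+ e ] ℤ.- + m ≡ -[1+ e ℕ.+ m ]
  -[1+e]-m zero    = ≡.cong -[1+_] (≡.sym (ℕₚ.+-identityʳ e))
  -[1+e]-m (suc m) = ≡.cong -[1+_] (≡.sym (ℕₚ.+-suc e m))

-- All exponents i-2N-m are negative, hence `x^_` is specified at negative integers.
record IsInverse (R : CommutativeRing 0ℓ 0ℓ) (x x⁻¹ : CommutativeRing.Carrier R)
  (x^_ : ℤ → CommutativeRing.Carrier R) : Set where
  open CommutativeRing R
  open Exp commutativeSemiring
  field
    xx⁻¹≈1 : x * x⁻¹ ≈ 1#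
    x^-neg : ∀ n → (x^ -[1+ n ]) ≈ x⁻¹ ^ suc n

module Evaluation (R : CommutativeRing 0ℓ 0ℓ)
  (ι : Poly → CommutativeRing.Carrier R)
  (ι-hom : RingMorphisms.IsRingHomomorphism polyRawRing (CommutativeRing.rawRing R) ι)
  (x⁻¹ : CommutativeRing.Carrier R) (x^_ : ℤ → CommutativeRing.Carrier R)
  (isInverse : IsInverse R (ι X) x⁻¹ x^_)
  where

  open CommutativeRing R
  open Exp commutativeSemiring
  open IsInverse isInverse
  open RingMorphisms polyRawRing rawRing using (module IsRingHomomorphism)
  open IsRingHomomorphism ι-hom using ()
    renaming (⟦⟧-cong to ι-cong; +-homo to ι-+; *-homo to ι-*; -‿homo to ι-neg;
              0#-homo to ι-0; 1#-homo to ι-1)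
  open FormalSeries R
  open RingSum R
  open SetoidReasoning setoid
  open import Algebra.Solver.Ring.NaturalCoefficients.Default commutativeSemiring

  κ : ℚ → Carrier
  κ c = ι (constₚ c)

  κ-* : ∀ c d → κ (c ℚ.* d) ≈ κ c * κ d
  κ-* c d = trans (ι-cong (constₚ-* c d)) (ι-* (constₚ c) (constₚ d))

  κ-fromℕ : ∀ n → κ (fromℕ n) ≈ ν n
  κ-fromℕ zero    = trans (ι-cong constₚ-0) ι-0
  κ-fromℕ (suc n) = trans (reflexive (≡.cong κ (fromℕ-+ 1 n)))
    (trans (ι-+ (constₚ 1ℚ) (constₚ (fromℕ n))) (+-cong ι-1 (κ-fromℕ n)))

  κ-sgn : ∀ k → κ (sgn k) ≈ (- 1#) ^ k
  κ-sgn zero    = ι-1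
  κ-sgn (suc k) = trans (κ-* (ℚ.- 1ℚ) (sgn k))
    (*-cong (trans (ι-neg (constₚ 1ℚ)) (-‿cong ι-1)) (κ-sgn k))

  Φ : PowerSeries → Series
  Φ f n = ι (f n)

  ι-∑< : ∀ n f → ι (RingSum.∑< polyRing n f) ≈ ∑[ k < n ] ι (f k)
  ι-∑< zero    f = ι-0
  ι-∑< (suc n) f = trans (ι-+ (f 0) (RingSum.∑< polyRing n (f ∘ suc))) (+-congˡ (ι-∑< n (f ∘ suc)))

  Φ-* : ∀ f g → Φ (f Series.* g) ≈ₛ Φ f *ₛ Φ g
  Φ-* f g n = trans (ι-∑< (suc n) (λ k → f k *ₚ g (n ∸ k)))
    (∑<-cong (suc n) λ k _ → ι-* (f k) (g (n ∸ k)))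

  Φ-const : ∀ p → Φ (constₛ p) ≈ₛ const (ι p)
  Φ-const p zero    = refl
  Φ-const p (suc n) = ι-0

  Φ-1 : Φ Series.1# ≈ₛ const 1#
  Φ-1 = S.trans (Φ-const (constₚ 1ℚ)) (const-cong ι-1)

  Φ-t : Φ Series.t ≈ₛ t
  Φ-t zero          = ι-0
  Φ-t (suc zero)    = ι-1
  Φ-t (suc (suc n)) = ι-0

  Φ-^ : ∀ f k → Φ (f Series.^ k) ≈ₛ Φ f S.^ k
  Φ-^ f zero    = Φ-1
  Φ-^ f (suc k) = S.trans (Φ-* f (f Series.^ k)) (S.*-congˡ {Φ f} (Φ-^ f k))

  Φ-inverse : ∀ f → Φ (Series.inverse f) ≈ₛ neumann (Φ (Series.1# Series.- f))
  Φ-inverse f n = trans (ι-∑< (suc n) (λ k → ((Series.1# Series.- f) Series.^ k) n))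
    (∑<-cong (suc n) λ k _ → Φ-^ (Series.1# Series.- f) k n)

  x : Carrier
  x = ι X

  linear denominator : PowerSeries
  linear      = constₛ (constₚ (fromℕ 2) *ₚ X) Series.* Series.t
  denominator = (Series.1# Series.- linear) Series.+ Series.t Series.* Series.t

  Φ-linear : Φ linear ≈ₛ (2 S.× const 1#) *ₛ (const x *ₛ t)
  Φ-linear = S.trans (Φ-* (constₛ (constₚ (fromℕ 2) *ₚ X)) Series.t)
    (S.trans (S.*-cong (S.trans (Φ-const (constₚ (fromℕ 2) *ₚ X))
               (S.trans (const-cong (trans (ι-* (constₚ (fromℕ 2)) X) (*-congʳ (κ-fromℕ 2))))
                 (S.trans (const-*-const (ν 2) x) (S.*-congʳ {const x} (S.sym (×1-const 2))))))
               Φ-t)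
             (S.*-assoc (2 S.× const 1#) (const x) t))

  -- Equal to 2xt - t²: the image of the series whose powers `Series.inverse` adds up to invert
  -- `denominator`.
  δ : Series
  δ = Φ (Series.1# Series.- denominator)

  δ-equation : δ +ₛ t *ₛ t ≈ₛ (2 S.× const 1#) *ₛ (const x *ₛ t)
  δ-equation = S.trans (S.+-congʳ {t *ₛ t} δ≈) (S.trans
    (Resolvent.complement seriesRing (Φ linear) (t *ₛ t)) Φ-linear)
    where
    Φ-minus : ∀ f g → Φ (f Series.- g) ≈ₛ Φ f S.- Φ g
    Φ-minus f g n = trans (ι-+ (f n) (-ₚ g n)) (+-congˡ (ι-neg (g n)))
    δ≈ : δ ≈ₛ const 1# S.- ((const 1# S.- Φ linear) +ₛ t *ₛ t)
    δ≈ = S.trans (Φ-minus Series.1# denominator) (S.+-cong Φ-1 (S.-‿cong (S.trans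
      (λ n → ι-+ ((Series.1# Series.- linear) n) ((Series.t Series.* Series.t) n))
      (S.+-cong (S.trans (Φ-minus Series.1# linear) (S.+-congʳ {S.- Φ linear} Φ-1))
                (S.trans (Φ-* Series.t Series.t) (S.*-cong Φ-t Φ-t))))))

  -- Read off from `δ-equation` in degree 0, where t² and 2xt have no coefficient. It is what makes
  -- the sum of the powers of `δ` an inverse.
  δ₀≈0 : δ 0 ≈ 0#
  δ₀≈0 = begin
    δ 0                          ≈⟨ solve 1 (λ d → d := d :+ (con 0 :* con 0 :+ con 0)) refl (δ 0) ⟩
    δ 0 + (0# * 0# + 0#)         ≈⟨ δ-equation 0 ⟩
    ν 2 * (x * 0# + 0#) + 0#
      ≈⟨ solve 2 (λ a x → a :* (x :* con 0 :+ con 0) :+ con 0 := con 0) refl (ν 2) x ⟩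
    0# ∎

  G : Series
  G = Φ generatingSeries

  G-equation : (const 1# +ₛ t *ₛ t) *ₛ G ≈ₛ
    (const 1# +ₛ t) +ₛ (2 S.× const 1#) *ₛ (const x *ₛ t) *ₛ G
  G-equation = S.trans (S.*-congˡ {const 1# +ₛ t *ₛ t} G≈)
    (S.trans (Resolvent.resolvent-equation seriesRing δ (neumann δ) t
        ((2 S.× const 1#) *ₛ (const x *ₛ t)) (neumann-unfold δ δ₀≈0) δ-equation)
      (S.+-congˡ {const 1# +ₛ t} (S.*-congˡ {(2 S.× const 1#) *ₛ (const x *ₛ t)} (S.sym G≈))))
    where
    G≈ : G ≈ₛ (const 1# +ₛ t) *ₛ neumann δ
    G≈ = S.trans (Φ-* (Series.1# Series.+ Series.t) (Series.inverse denominator))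
      (S.*-cong (S.trans (λ n → ι-+ (Series.1# n) (Series.t n)) (S.+-cong Φ-1 Φ-t))
                (Φ-inverse denominator))

  -- 1/(1+t) and 1/(x-t), the latter as (1/x) · 1/(1 - t/x).
  u y : Series
  u = geometric (- 1#)
  y = const x⁻¹ *ₛ geometric x⁻¹

  u-inverse : u *ₛ (const 1# +ₛ t) ≈ₛ const 1#
  u-inverse = Resolvent.inverse-1+t seriesRing u (const (- 1#)) t (geometric-unfold (- 1#))
    λ { zero → -‿inverseˡ 1# ; (suc n) → +-identityˡ 0# }

  y-inverse : const x *ₛ y ≈ₛ const 1# +ₛ t *ₛ y
  y-inverse = Resolvent.inverse-x-t seriesRing (const x) (const x⁻¹) (geometric x⁻¹) t
    (S.trans (S.sym (const-*-const x x⁻¹)) (const-cong xx⁻¹≈1)) (geometric-unfold x⁻¹)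

  ∂-isDerivation : IsDerivation seriesRing ∂
  ∂-isDerivation = record
    { ∂-cong = λ {f} {g} → ∂-cong {f} {g}
    ; ∂-+    = ∂-+
    ; ∂-*    = ∂-*
    }

  module ∂ₛ = Derivation seriesRing ∂ ∂-isDerivation
  open ∂ₛ using (∂^)
  open ∂ₛ.Expansion (const x) t u y G (∂-const x) ∂-t u-inverse y-inverse G-equation
    using (F; summand; power-expansion; ∂^-F)

  -- The l-th derivative of t^(p+l) is (p+l)_l t^p; each differentiation supplies one factor of the
  -- falling factorial.
  ∂^-coefficient : ∀ l p → ∂^ l G p ≈ κ (fallingFactorial (fromℕ (p ℕ.+ l)) l) * ι (W (p ℕ.+ l))
  ∂^-coefficient zero    p = sym (trans (*-cong ι-1 (reflexive (≡.cong (ι ∘ W) (ℕₚ.+-identityʳ p))))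
                                        (*-identityˡ (G p)))
  ∂^-coefficient (suc l) p = begin
    ν (suc p) * ∂^ l G (suc p)
      ≈⟨ *-cong (sym (κ-fromℕ (suc p))) (∂^-coefficient l (suc p)) ⟩
    κ (fromℕ (suc p)) * (κ q * ι (W (suc p ℕ.+ l)))
      ≈⟨ solve 3 (λ a b c → a :* (b :* c) := b :* a :* c) refl
           (κ (fromℕ (suc p))) (κ q) (ι (W (suc p ℕ.+ l))) ⟩
    κ q * κ (fromℕ (suc p)) * ι (W (suc p ℕ.+ l))
      ≈⟨ *-congʳ (κ-* q (fromℕ (suc p))) ⟨
    κ (q ℚ.* fromℕ (suc p)) * ι (W (suc p ℕ.+ l))
      ≈⟨ *-cong (reflexive (≡.cong κ (fallingFactorial-fromℕ p l)))
                (reflexive (≡.cong (ι ∘ W) (ℕₚ.+-suc p l))) ⟨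
    κ (fallingFactorial (fromℕ (p ℕ.+ suc l)) (suc l)) * ι (W (p ℕ.+ suc l)) ∎
    where q = fallingFactorial (fromℕ (suc p ℕ.+ l)) l

  y^-coefficient : ∀ e m → (y S.^ suc e) m ≈ ν ((e ℕ.+ m) C m) * x⁻¹ ^ suc (e ℕ.+ m)
  y^-coefficient e m = begin
    (y S.^ suc e) m
      ≈⟨ S.^-distrib-* (const x⁻¹) (geometric x⁻¹) (suc e) m ⟩
    ((const x⁻¹ S.^ suc e) *ₛ (geometric x⁻¹ S.^ suc e)) m
      ≈⟨ S.*-cong (const-^ x⁻¹ (suc e)) (geometric-^ x⁻¹ e) m ⟩
    (const (x⁻¹ ^ suc e) *ₛ binomialSeries x⁻¹ e) m
      ≈⟨ const-* (x⁻¹ ^ suc e) (binomialSeries x⁻¹ e) m ⟩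
    x⁻¹ ^ suc e * (ν ((e ℕ.+ m) C m) * x⁻¹ ^ m)
      ≈⟨ solve 3 (λ a b c → a :* (b :* c) := b :* (a :* c)) refl
           (x⁻¹ ^ suc e) (ν ((e ℕ.+ m) C m)) (x⁻¹ ^ m) ⟩
    ν ((e ℕ.+ m) C m) * (x⁻¹ ^ suc e * x⁻¹ ^ m)
      ≈⟨ *-congˡ (^-homo-* x⁻¹ (suc e) m) ⟨
    ν ((e ℕ.+ m) C m) * x⁻¹ ^ suc (e ℕ.+ m) ∎

  -- `M` is 2N, kept free so that `i + suc e` can be substituted and the truncated subtractions
  -- evaluate.
  innerTerm : (M i l m s p : ℕ) → Carrier
  innerTerm M i l m s p =
    κ (sgn s ℚ.* fromℕ ((M ℕ.+ m ∸ i ∸ 1) C m)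
             ℚ.* fromℕ ((i ∸ l ℕ.+ s) C s)
             ℚ.* fallingFactorial (fromℕ (p ℕ.+ l)) l)
      * (x^ (+ i ℤ.- + M ℤ.- + m))
      * ι (W (p ℕ.+ l))

  innerSum : (M i l n : ℕ) → Carrier
  innerSum M i l n = ∑[ m < suc n ] ∑[ s < suc (n ∸ m) ] innerTerm M i l m s (n ∸ m ∸ s)

  -- One factor for each summation index: the coefficient of t^m in (x-t)^(-e-1), of t^s in
  -- (1+t)^(-(i-l+1)), and of t^p in ∂ˡG. The sum over m+s+p = n is then a triple Cauchy product.
  innerTerm-factor : ∀ i e l m s p → innerTerm (i ℕ.+ suc e) i l m s p ≈
    (y S.^ suc e) m * ((u S.^ suc (i ∸ l)) s * ∂^ l G p)
  innerTerm-factor i e l m s p = begin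
    κ (sgn s ℚ.* fromℕ ((M ℕ.+ m ∸ i ∸ 1) C m) ℚ.* c₂ ℚ.* f) * (x^ (+ i ℤ.- + M ℤ.- + m)) * w
      ≡⟨ ≡.cong₂ (λ k z → κ (sgn s ℚ.* fromℕ (k C m) ℚ.* c₂ ℚ.* f) * (x^ z) * w)
           binomial-top (exponent≡ i e m) ⟩
    κ (sgn s ℚ.* c₁ ℚ.* c₂ ℚ.* f) * (x^ -[1+ e ℕ.+ m ]) * w
      ≈⟨ *-congʳ (*-cong κ-split (x^-neg (e ℕ.+ m))) ⟩
    (- 1#) ^ s * ν ((e ℕ.+ m) C m) * ν ((i ∸ l ℕ.+ s) C s) * κ f * x⁻¹ ^ suc (e ℕ.+ m) * w
      ≈⟨ solve 6 (λ σ a b f x w → σ :* a :* b :* f :* x :* w := a :* x :* (b :* σ :* (f :* w))) refl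
           ((- 1#) ^ s) (ν ((e ℕ.+ m) C m)) (ν ((i ∸ l ℕ.+ s) C s)) (κ f) (x⁻¹ ^ suc (e ℕ.+ m)) w ⟩
    ν ((e ℕ.+ m) C m) * x⁻¹ ^ suc (e ℕ.+ m) * (binomialSeries (- 1#) (i ∸ l) s * (κ f * w))
      ≈⟨ *-cong (y^-coefficient e m) (*-cong (geometric-^ (- 1#) (i ∸ l) s) (∂^-coefficient l p)) ⟨
    (y S.^ suc e) m * ((u S.^ suc (i ∸ l)) s * ∂^ l G p) ∎
    where
    M  = i ℕ.+ suc e
    c₁ = fromℕ ((e ℕ.+ m) C m)
    c₂ = fromℕ ((i ∸ l ℕ.+ s) C s)
    f  = fallingFactorial (fromℕ (p ℕ.+ l)) l
    w  = ι (W (p ℕ.+ l))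
    binomial-top : M ℕ.+ m ∸ i ∸ 1 ≡ e ℕ.+ m
    binomial-top = ≡.cong (_∸ 1) (≡.trans (≡.cong (_∸ i) (ℕₚ.+-assoc i (suc e) m))
                                          (ℕₚ.m+n∸m≡n i (suc e ℕ.+ m)))
    κ-split : κ (sgn s ℚ.* c₁ ℚ.* c₂ ℚ.* f) ≈
              (- 1#) ^ s * ν ((e ℕ.+ m) C m) * ν ((i ∸ l ℕ.+ s) C s) * κ f
    κ-split = trans (κ-* (sgn s ℚ.* c₁ ℚ.* c₂) f) (*-congʳ (trans (κ-* (sgn s ℚ.* c₁) c₂)
      (*-cong (trans (κ-* (sgn s) c₁) (*-cong (κ-sgn s) (κ-fromℕ ((e ℕ.+ m) C m))))
              (κ-fromℕ ((i ∸ l ℕ.+ s) C s)))))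

  innerSum-coefficient : ∀ i e l n → innerSum (i ℕ.+ suc e) i l n ≈
    ((y S.^ suc e) *ₛ ((u S.^ suc (i ∸ l)) *ₛ ∂^ l G)) n
  innerSum-coefficient i e l n = ∑<-cong (suc n) λ m _ → trans
    (∑<-cong (suc (n ∸ m)) λ s _ → innerTerm-factor i e l m s (n ∸ m ∸ s))
    (sym (*-distribˡ-∑< (suc (n ∸ m)) ((y S.^ suc e) m)
           λ s → (u S.^ suc (i ∸ l)) s * ∂^ l G (n ∸ m ∸ s)))

  b : ℕ → ℕ → Series
  b i l = const (κ (leibnizCoefficient i l))

  b-diagonal : ∀ i → b i i ≈ₛ const 1#
  b-diagonal i = const-cong (trans (reflexive (≡.cong κ (leibnizCoefficient-diagonal i))) ι-1)

  b-suc : ∀ i l → l ℕ.≤ i → b (suc i) l ≈ₛ S.- (suc i S.× const 1#) *ₛ b i l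
  b-suc i l l≤i = S.trans (const-cong κ-step) (S.trans
    (const-*-const (- ν (suc i)) (κ (leibnizCoefficient i l)))
    (S.*-congʳ {b i l} neg-const))
    where
    κ-step : κ (leibnizCoefficient (suc i) l) ≈ - ν (suc i) * κ (leibnizCoefficient i l)
    κ-step = trans (reflexive (≡.cong κ (leibnizCoefficient-suc i l l≤i)))
      (trans (κ-* (ℚ.- fromℕ (suc i)) (leibnizCoefficient i l))
             (*-congʳ (trans (ι-neg (constₚ (fromℕ (suc i)))) (-‿cong (κ-fromℕ (suc i))))))
    neg-0 : - 0# ≈ 0#
    neg-0 = trans (sym (+-identityʳ (- 0#))) (-‿inverseˡ 0#)
    neg-const : const (- ν (suc i)) ≈ₛ S.- (suc i S.× const 1#)
    neg-const zero    = -‿cong (sym (×1-const (suc i) 0))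
    neg-const (suc n) = trans (sym neg-0) (-‿cong (sym (×1-const (suc i) (suc n))))

  outerTerm : (N n i l : ℕ) → Carrier
  outerTerm N n i l = κ (sgn (i ∸ l) ℚ.* a i N ℚ.* (i !/ l !)) * innerSum (2 ℕ.* N) i l n

  summand-coefficient : ∀ N n i → 1 ℕ.≤ i → i ℕ.≤ N →
    summand N i n ≈ ∑[ l < suc i ] outerTerm N n i l
  summand-coefficient N n i 1≤i i≤N = begin
    summand N i n
      ≈⟨ ×1-coefficient (A i N) ((y S.^ (2 ℕ.* N ∸ i)) *ₛ ∂^ i F) n ⟩
    ν (A i N) * ((y S.^ (2 ℕ.* N ∸ i)) *ₛ ∂^ i F) n
      ≡⟨ ≡.cong (λ k → ν (A i N) * ((y S.^ k) *ₛ ∂^ i F) n) 2N∸i≡ ⟩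
    ν (A i N) * (Y *ₛ ∂^ i F) n
      ≈⟨ *-congˡ (S.*-congˡ {Y} (∂^-F b b-diagonal b-suc i) n) ⟩
    ν (A i N) * (Y *ₛ ∑<ₛ (suc i) (λ l → b i l *ₛ V l)) n
      ≈⟨ *-congˡ (trans (RingSum.*-distribˡ-∑< seriesRing (suc i) Y (λ l → b i l *ₛ V l) n)
                        (∑<ₛ-coefficient (suc i) (λ l → Y *ₛ (b i l *ₛ V l)) n)) ⟩
    ν (A i N) * (∑[ l < suc i ] ((Y *ₛ (b i l *ₛ V l)) n))
      ≈⟨ *-distribˡ-∑< (suc i) (ν (A i N)) (λ l → (Y *ₛ (b i l *ₛ V l)) n) ⟩
    (∑[ l < suc i ] (ν (A i N) * (Y *ₛ (b i l *ₛ V l)) n))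
      ≈⟨ ∑<-cong (suc i) (λ l _ → term l) ⟩
    (∑[ l < suc i ] outerTerm N n i l) ∎
    where
    ∑<ₛ = RingSum.∑< seriesRing
    -- The exponent 2N-i is positive since 1 ≤ i ≤ N, so it can be written as `suc e`, the form
    -- required by the binomial series.
    e = 2 ℕ.* N ∸ i ∸ 1
    Y = y S.^ suc e
    V : ℕ → Series
    V l = (u S.^ suc (i ∸ l)) *ₛ ∂^ l G
    i<2N : i ℕ.< 2 ℕ.* N
    i<2N = ℕₚ.<-≤-trans (ℕₚ.m<m+n i (ℕₚ.≤-trans 1≤i i≤N))
      (≡.subst (i ℕ.+ N ℕ.≤_) (≡.cong (N ℕ.+_) (≡.sym (ℕₚ.+-identityʳ N))) (ℕₚ.+-monoˡ-≤ N i≤N))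
    2N∸i≡ : 2 ℕ.* N ∸ i ≡ suc e
    2N∸i≡ = ≡.sym (ℕₚ.m+[n∸m]≡n {1} (ℕₚ.m<n⇒0<n∸m i<2N))
    2N≡ : i ℕ.+ suc e ≡ 2 ℕ.* N
    2N≡ = ≡.trans (≡.cong (i ℕ.+_) (≡.sym 2N∸i≡)) (ℕₚ.m+[n∸m]≡n (ℕₚ.<⇒≤ i<2N))
    term : ∀ l → ν (A i N) * (Y *ₛ (b i l *ₛ V l)) n ≈ outerTerm N n i l
    term l = begin
      ν (A i N) * (Y *ₛ (b i l *ₛ V l)) n
        ≈⟨ *-congˡ (trans (commute Y (b i l) (V l) n)
                         (const-* (κ (leibnizCoefficient i l)) (Y *ₛ V l) n)) ⟩
      ν (A i N) * (κ (leibnizCoefficient i l) * (Y *ₛ V l) n)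
        ≈⟨ *-assoc (ν (A i N)) (κ (leibnizCoefficient i l)) ((Y *ₛ V l) n) ⟨
      ν (A i N) * κ (leibnizCoefficient i l) * (Y *ₛ V l) n
        ≈⟨ *-cong coefficient≈ (sym (trans
             (reflexive (≡.cong (λ M → innerSum M i l n) (≡.sym 2N≡))) (innerSum-coefficient i e l n))) ⟩
      outerTerm N n i l ∎
      where
      commute : ∀ f g h → f *ₛ (g *ₛ h) ≈ₛ g *ₛ (f *ₛ h)
      commute f g h = S.trans (S.sym (S.*-assoc f g h))
        (S.trans (S.*-congʳ {h} (S.*-comm f g)) (S.*-assoc g f h))
      coefficient≈ : ν (A i N) * κ (leibnizCoefficient i l) ≈ κ (sgn (i ∸ l) ℚ.* a i N ℚ.* (i !/ l !))
      coefficient≈ = begin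
        ν (A i N) * κ (leibnizCoefficient i l)
          ≈⟨ *-congʳ (κ-fromℕ (A i N)) ⟨
        κ (fromℕ (A i N)) * κ (leibnizCoefficient i l)
          ≈⟨ κ-* (fromℕ (A i N)) (leibnizCoefficient i l) ⟨
        κ (fromℕ (A i N) ℚ.* leibnizCoefficient i l)
          ≡⟨ ≡.cong κ (≡.trans (≡.sym (ℚₚ.*-assoc (fromℕ (A i N)) (sgn (i ∸ l)) (i !/ l !)))
               (≡.cong (ℚ._* (i !/ l !)) (≡.trans (ℚₚ.*-comm (fromℕ (A i N)) (sgn (i ∸ l)))
                 (≡.cong (sgn (i ∸ l) ℚ.*_) (≡.sym (a≡A i N 1≤i i≤N)))))) ⟩
        κ (sgn (i ∸ l) ℚ.* a i N ℚ.* (i !/ l !)) ∎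

  F^-coefficient : ∀ N n → (∑[ l < suc n ]
      (κ (sgn (n ∸ l) ℚ.* fromℕ ((N ℕ.+ n ∸ l) C (n ∸ l))) * ι (W^⟨ N ℕ.+ 1 ⟩ l)))
    ≈ (F S.^ suc N) n
  F^-coefficient N n = begin
    (∑[ l < suc n ]
      (κ (sgn (n ∸ l) ℚ.* fromℕ ((N ℕ.+ n ∸ l) C (n ∸ l))) * ι (W^⟨ N ℕ.+ 1 ⟩ l)))
      ≈⟨ ∑<-cong (suc n) (λ l l<1+n → term l (ℕₚ.≤-pred l<1+n)) ⟩
    ((G S.^ suc N) *ₛ (u S.^ suc N)) n
      ≈⟨ S.*-comm (G S.^ suc N) (u S.^ suc N) n ⟩
    ((u S.^ suc N) *ₛ (G S.^ suc N)) n
      ≈⟨ S.^-distrib-* u G (suc N) n ⟨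
    (F S.^ suc N) n ∎
    where
    term : ∀ l → l ℕ.≤ n →
      κ (sgn (n ∸ l) ℚ.* fromℕ ((N ℕ.+ n ∸ l) C (n ∸ l))) * ι (W^⟨ N ℕ.+ 1 ⟩ l)
      ≈ (G S.^ suc N) l * (u S.^ suc N) (n ∸ l)
    term l l≤n = begin
      κ (sgn j ℚ.* fromℕ ((N ℕ.+ n ∸ l) C j)) * ι (W^⟨ N ℕ.+ 1 ⟩ l)
        ≡⟨ ≡.cong₂ (λ k m → κ (sgn j ℚ.* fromℕ (k C j)) * ι (W^⟨ m ⟩ l))
             (ℕₚ.+-∸-assoc N l≤n) (ℕₚ.+-comm N 1) ⟩
      κ (sgn j ℚ.* fromℕ ((N ℕ.+ j) C j)) * ι (W^⟨ suc N ⟩ l)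
        ≈⟨ *-cong (trans (κ-* (sgn j) (fromℕ ((N ℕ.+ j) C j)))
                         (*-cong (κ-sgn j) (κ-fromℕ ((N ℕ.+ j) C j))))
                  (Φ-^ generatingSeries (suc N) l) ⟩
      (- 1#) ^ j * ν ((N ℕ.+ j) C j) * (G S.^ suc N) l
        ≈⟨ trans (*-comm _ _) (*-congˡ (*-comm _ _)) ⟩
      (G S.^ suc N) l * binomialSeries (- 1#) N j
        ≈⟨ *-congˡ (geometric-^ (- 1#) N j) ⟨
      (G S.^ suc N) l * (u S.^ suc N) j ∎
      where j = n ∸ l

  identity : ∀ N n → 1 ℕ.≤ N →
    (∑[ l < suc n ]
      (κ (sgn (n ∸ l) ℚ.* fromℕ ((N ℕ.+ n ∸ l) C (n ∸ l))) * ι (W^⟨ N ℕ.+ 1 ⟩ l)))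
    ≈ κ (1/2^ N * N !) * (∑[ i < N ] ∑[ l < 2 ℕ.+ i ] outerTerm N n (suc i) l)
  identity N@(suc N-1) n _ = begin
    _
      ≈⟨ F^-coefficient N n ⟩
    (F S.^ suc N) n
      ≈⟨ trans (*-congʳ κ-inverse) (*-identityˡ _) ⟨
    κ (1/2^ N * N !) * ν c * (F S.^ suc N) n
      ≈⟨ trans (*-assoc _ _ _) (*-congˡ (sym (×1-coefficient c (F S.^ suc N) n))) ⟩
    κ (1/2^ N * N !) * ((c S.× const 1#) *ₛ (F S.^ suc N)) n
      ≈⟨ *-congˡ (trans (power-expansion N n) (∑<ₛ-coefficient (suc N) (summand N) n)) ⟩
    κ (1/2^ N * N !) * (∑[ i < suc N ] summand N i n)
      -- The term `i = 0` is zero by `A-zero`; this uses N ≥ 1, as `A 0 0` is 1.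
      ≈⟨ *-congˡ (+-cong summand-zero (∑<-cong N λ i i<N →
           summand-coefficient N n (suc i) (s≤s z≤n) i<N)) ⟩
    κ (1/2^ N * N !) * (0# + (∑[ i < N ] ∑[ l < 2 ℕ.+ i ] outerTerm N n (suc i) l))
      ≈⟨ *-congˡ (+-identityˡ _) ⟩
    κ (1/2^ N * N !) * (∑[ i < N ] ∑[ l < 2 ℕ.+ i ] outerTerm N n (suc i) l) ∎
    where
    c = 2 ℕ.^ N ℕ.* N !
    κ-inverse : κ (1/2^ N * N !) * ν c ≈ 1#
    κ-inverse = trans (*-congˡ (sym (κ-fromℕ c))) (trans (sym (κ-* (1/2^ N * N !) (fromℕ c)))
      (trans (reflexive (≡.cong κ (1/2^*!-cancel N))) ι-1))
    summand-zero : summand N 0 n ≈ 0#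
    summand-zero = trans (×1-coefficient (A 0 N) ((y S.^ (2 ℕ.* N)) *ₛ F) n)
      (trans (*-congʳ (reflexive (≡.cong ν (A-zero N-1)))) (zeroˡ _))

open import Data.Nat using (_≤_; _+_)
open import Defs using (_*_)

theorem6 : ∀ (N n : ℕ) → 1 ≤ N →
    ∑[ l ∈ 0 ⋯ n ]
    scalar (sgn (n ∸ l) ℚ.* fromℕ ((N + n ∸ l) C (n ∸ l))) * ι (W^⟨ N + 1 ⟩ l)
    ≃
    scalar (1/2^ N * N !) *
    (∑[ i ∈ 1 ⋯ N ] ∑[ l ∈ 0 ⋯ i ]
    scalar (sgn (i ∸ l) ℚ.* a i N ℚ.* (i !/ l !)) *
    (∑[m+s+p= n ] λ m s p →
    scalar (sgn s ℚ.* fromℕ ((2 ℕ.* N + m ∸ i ∸ 1) C m)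
    ℚ.* fromℕ ((i ∸ l + s) C s)
    ℚ.* fallingFactorial (fromℕ (p + l)) l)
    * x^ (+ i ℤ.- + (2 ℕ.* N) ℤ.- + m)
    * ι (W (p + l))))
-- The ranges from 0 and from 1 in the statement reduce definitionally to the sums in `identity`,
-- and a negative power of x is by definition a power of the fraction 1/X.
theorem6 = Evaluation.identity ratFunRing ι ι-isRingHomomorphism
  (frac (constₚ 1ℚ) X X≉0) x^_ record { xx⁻¹≈1 = X*1/X ; x^-neg = λ _ _ → ≡.refl }
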